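{- Let $\psi$ be the real root of $x^3=x^2+x+1$. For all integers $n\ge0$, $$\lfloor\psi n\rfloor-1\le A_n\le\lfloor\psi n\rfloor+1,$$ $$\lfloor\psi^2n\rfloor-2\le B_n\le\lfloor\psi^2n\rfloor+1,$$ $$\lfloor\psi^3n\rfloor-3\le C_n\le\lfloor\psi^3n\rfloor+1.$$
   Context: The Tribonacci word $\mathbf T=t_1t_2t_3\cdots$ (indexed from $1$) is the infinite fixed point, beginning with $a$, of the morphism $\tau: a\to ab,\ b\to ac,\ c\to a$. For $n\ge1$, $A_n$ (resp. $B_n$, $C_n$) is the index of the $n$th occurrence of the letter $a$ (resp. $b$, $c$) in $\mathbf T$; also $A_0=B_0=C_0=0$. -}

module Defs where

open import Data.Empty using (⊥)
open import Data.Fin.Base using (fromℕ<)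
open import Data.Integer.Base as ℤ using (ℤ; +_)
open import Data.List.Base using (List; []; _∷_; [_]; _++_; length; concatMap; filter; applyUpTo; lookup)
open import Data.List.Properties using (∷-injectiveˡ; ∷-injectiveʳ; ++-assoc; ++-identityʳ; length-++; filter-++; applyUpTo-∷ʳ; concatMap-++)
open import Data.Nat.Base as ℕ using (ℕ; zero; suc; _⊔_)
import Data.Nat.Properties as ℕ
import Data.Integer.Properties as ℤ
open import Data.Product.Base using (Σ; ∃; _×_; _,_; proj₁; proj₂)
open import Data.Rational.Base as ℚ using (ℚ; 0ℚ; 1ℚ)
import Data.Rational.Properties as ℚ
open import Data.Rational.Solver using (module +-*-Solver)
open import Relation.Binary.Definitions using (DecidableEquality)
open import Relation.Binary.PropositionalEquality using (_≡_; refl; sym; trans; cong; cong₂; subst; subst₂)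
open import Relation.Nullary using (yes; no; contradiction)

private module Bisection where
  open import Data.Rational.Base
  open import Data.Rational.Properties
  open import Data.Rational.Unnormalised.Base as ℚᵘ using (mkℚᵘ; *≡*)
  import Data.Rational.Unnormalised.Properties as ℚᵘ
  open import Data.Sum.Base using (inj₁; inj₂)
  open import Relation.Nullary using (Dec)
  open +-*-Solver

  2ℚ : ℚ
  2ℚ = 1ℚ + 1ℚ

  h : ℕ → ℚ
  h zero    = 1ℚ
  h (suc k) = ½ * h k

  h+h : ∀ k → h (suc k) + h (suc k) ≡ h k
  h+h k = trans (sym (*-distribʳ-+ (h k) ½ ½)) (*-identityˡ (h k))

  0≤h : ∀ k → 0ℚ ≤ h k
  0≤h zero    = nonNegative⁻¹ 1ℚ
  0≤h (suc k) = subst (_≤ ½ * h k) (*-zeroʳ ½) (*-monoˡ-≤-nonNeg ½ (0≤h k))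

  h≤1 : ∀ k → h k ≤ 1ℚ
  h≤1 zero    = ≤-refl
  h≤1 (suc k) = ≤-trans (subst (_≤ h (suc k) + h (suc k)) (+-identityˡ (h (suc k)))
    (+-monoˡ-≤ (h (suc k)) (0≤h (suc k)))) (subst (_≤ 1ℚ) (sym (h+h k)) (h≤1 k))

  ι : ℕ → ℚ
  ι zero    = 0ℚ
  ι (suc n) = ι n + 1ℚ

  ι≃ : ∀ n → toℚᵘ (ι n) ℚᵘ.≃ mkℚᵘ (+ n) 0
  ι≃ zero    = *≡* refl
  ι≃ (suc n) = begin
    toℚᵘ (ι n + 1ℚ)             ≈⟨ toℚᵘ-homo-+ (ι n) 1ℚ ⟩
    toℚᵘ (ι n) ℚᵘ.+ toℚᵘ 1ℚ     ≈⟨ ℚᵘ.+-congˡ (toℚᵘ 1ℚ) (ι≃ n) ⟩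
    mkℚᵘ (+ n) 0 ℚᵘ.+ toℚᵘ 1ℚ   ≈⟨ *≡* (cong (ℤ._* + 1) (trans (cong (ℤ._+ + 1) (ℤ.*-identityʳ (+ n))) (ℤ.+-comm (+ n) (+ 1)))) ⟩
    mkℚᵘ (+ suc n) 0            ∎
    where open import Relation.Binary.Reasoning.Setoid ℚᵘ.≃-setoid

  0≤ι : ∀ n → 0ℚ ≤ ι n
  0≤ι zero    = ≤-refl
  0≤ι (suc n) = +-mono-≤ (0≤ι n) (nonNegative⁻¹ 1ℚ)

  hι<1 : ∀ n → h n * ι n < 1ℚ
  hι<1 zero    = positive⁻¹ 1ℚ
  hι<1 (suc n) = subst₂ _<_
    (solve 3 (λ e x y → e :* (x :* y) :+ e :* x := (e :* x) :* (y :+ con 1ℚ)) refl ½ (h n) (ι n))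
    refl
    (+-mono-<-≤ (*-monoʳ-<-pos ½ (hι<1 n)) (*-monoˡ-≤-nonNeg ½ (h≤1 n)))

  h→0 : ∀ ε → 0ℚ < ε → ∃ λ N → h N < ε
  h→0 ε@(mkℚ (+ zero) d c)  0<ε = contradiction (positive 0<ε) λ ()
  h→0 ε@(mkℚ ℤ.-[1+ n ] d c) 0<ε = contradiction (positive 0<ε) λ ()
  h→0 ε@(mkℚ (+ suc n) d c) 0<ε = suc d , *-cancelʳ-<-nonNeg (ι (suc d)) {{nonNegative (0≤ι (suc d))}}
    (<-≤-trans (hι<1 (suc d)) (subst (1ℚ ≤_) (sym ει) (≤-trans (≤-reflexive (sym (+-identityˡ 1ℚ))) (+-monoˡ-≤ 1ℚ (0≤ι n)))))
    where
    ει : ε * ι (suc d) ≡ ι (suc n)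
    ει = toℚᵘ-injective (begin
      toℚᵘ (ε * ι (suc d))                 ≈⟨ toℚᵘ-homo-* ε (ι (suc d)) ⟩
      mkℚᵘ (+ suc n) d ℚᵘ.* toℚᵘ (ι (suc d)) ≈⟨ ℚᵘ.*-congˡ {x = mkℚᵘ (+ suc n) d} (ι≃ (suc d)) ⟩
      mkℚᵘ (+ suc n) d ℚᵘ.* mkℚᵘ (+ suc d) 0 ≈⟨ *≡* (trans (ℤ.*-identityʳ _) (cong (λ m → + suc n ℤ.* (+ suc m)) (sym (ℕ.*-identityʳ d)))) ⟩
      mkℚᵘ (+ suc n) 0                     ≈⟨ ι≃ (suc n) ⟨
      toℚᵘ (ι (suc n))                     ∎)
      where open import Relation.Binary.Reasoning.Setoid ℚᵘ.≃-setoid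

  p : ℚ → ℚ
  p x = x * (x * (x * 1ℚ)) - (x * (x * 1ℚ) + x + 1ℚ)

  record Bracket (k : ℕ) : Set where
    field
      lo    : ℚ
      1≤lo  : 1ℚ ≤ lo
      hi≤2  : lo + h k ≤ 2ℚ
      p-lo  : p lo ≤ 0ℚ
      p-hi  : 0ℚ ≤ p (lo + h k)
  open Bracket

  half-step : ∀ k x → (x + h (suc k)) + h (suc k) ≡ x + h k
  half-step k x = trans (+-assoc x (h (suc k)) (h (suc k))) (cong (λ y → x + y) (h+h k))

  x≤x+h : ∀ k x → x ≤ x + h k
  x≤x+h k x = subst (_≤ x + h k) (+-identityʳ x) (+-monoʳ-≤ x (0≤h k))

  refine : ∀ k (B : Bracket k) → Dec (p (lo B + h (suc k)) ≤ 0ℚ) → Bracket (suc k)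
  refine k B (yes p≤0) = record
    { lo   = lo B + h (suc k)
    ; 1≤lo = ≤-trans (1≤lo B) (x≤x+h (suc k) (lo B))
    ; hi≤2 = subst (_≤ 2ℚ) (sym (half-step k (lo B))) (hi≤2 B)
    ; p-lo = p≤0
    ; p-hi = subst (λ x → 0ℚ ≤ p x) (sym (half-step k (lo B))) (p-hi B)
    }
  refine k B (no p≰0) = record
    { lo   = lo B
    ; 1≤lo = 1≤lo B
    ; hi≤2 = ≤-trans (x≤x+h (suc k) (lo B + h (suc k))) (subst (_≤ 2ℚ) (sym (half-step k (lo B))) (hi≤2 B))
    ; p-lo = p-lo B
    ; p-hi = <⇒≤ (≰⇒> p≰0)
    }

  bracket : ∀ k → Bracket k
  bracket zero    = record
    { lo = 1ℚ ; 1≤lo = ≤-refl ; hi≤2 = ≤-refl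
    ; p-lo = nonPositive⁻¹ (p 1ℚ) ; p-hi = nonNegative⁻¹ (p 2ℚ) }
  bracket (suc k) = refine k (bracket k) (p (lo (bracket k) + h (suc k)) ≤? 0ℚ)

  root : ℕ → ℚ
  root k = lo (bracket k)

  refine-nested : ∀ k B d → lo B ≤ lo (refine k B d) × lo (refine k B d) + h (suc k) ≤ lo B + h k
  refine-nested k B (yes _) = x≤x+h (suc k) (lo B) , ≤-reflexive (half-step k (lo B))
  refine-nested k B (no _)  = ≤-refl
    , subst (lo B + h (suc k) ≤_) (half-step k (lo B)) (x≤x+h (suc k) (lo B + h (suc k)))

  nested : ∀ j k → root k ≤ root (j ℕ.+ k) × root (j ℕ.+ k) + h (j ℕ.+ k) ≤ root k + h k
  nested zero    k = ≤-refl , ≤-refl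
  nested (suc j) k =
    let l , u = nested j k
        l′ , u′ = refine-nested (j ℕ.+ k) (bracket (j ℕ.+ k)) (p (root (j ℕ.+ k) + h (suc (j ℕ.+ k))) ≤? 0ℚ)
    in ≤-trans l l′ , ≤-trans u′ u

  within : ∀ {N n} → N ℕ.≤ n → root N ≤ root n × root n ≤ root N + h N
  within {N} {n} N≤n = subst (λ m → root N ≤ root m × root m ≤ root N + h N) (ℕ.m∸n+n≡m N≤n)
    (let l , u = nested (n ℕ.∸ N) N in l , ≤-trans (x≤x+h (n ℕ.∸ N ℕ.+ N) _) u)

  ∣x-y∣≤ : ∀ l d x y → l ≤ x → x ≤ l + d → l ≤ y → y ≤ l + d → ∣ x - y ∣ ≤ d
  ∣x-y∣≤ l d x y l≤x x≤u l≤y y≤u with ∣p∣≡p∨∣p∣≡-p (x - y)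
  ... | inj₁ eq = subst₂ _≤_ (sym eq)
    (solve 2 (λ l d → (l :+ d) :- l := d) refl l d) (+-mono-≤ x≤u (neg-antimono-≤ l≤y))
  ... | inj₂ eq = subst₂ _≤_
    (trans (solve 2 (λ x y → y :- x := :- (x :- y)) refl x y) (sym eq))
    (solve 2 (λ l d → (l :+ d) :- l := d) refl l d) (+-mono-≤ y≤u (neg-antimono-≤ l≤x))

  root-cauchy : ∀ ε → 0ℚ < ε →
    ∃ λ N → ∀ m n → N ℕ.≤ m → N ℕ.≤ n → ∣ root m - root n ∣ < ε
  root-cauchy ε 0<ε = let N , hN<ε = h→0 ε 0<ε in N , λ m n N≤m N≤n →
    let lm , um = within N≤m
        ln , un = within N≤n
    in ≤-<-trans (∣x-y∣≤ (root N) (h N) (root m) (root n) lm um ln un) hN<ε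

  12ℚ : ℚ
  12ℚ = 2ℚ * 2ℚ + 2ℚ * 2ℚ + 2ℚ * 2ℚ

  *-mono : ∀ {x y u v} → 0ℚ ≤ x → 0ℚ ≤ v → x ≤ u → y ≤ v → x * y ≤ u * v
  *-mono {x} {y} {u} {v} 0≤x 0≤v x≤u y≤v = ≤-trans
    (*-monoˡ-≤-nonNeg x {{nonNegative 0≤x}} y≤v)
    (*-monoʳ-≤-nonNeg v {{nonNegative 0≤v}} x≤u)

  0≤2 : 0ℚ ≤ 2ℚ
  0≤2 = nonNegative⁻¹ 2ℚ

  p-small : ∀ k → ∣ p (root k) ∣ ≤ 12ℚ * h k
  p-small k = begin
    ∣ p l ∣      ≡⟨ ∣-p∣≡∣p∣ (p l) ⟨
    ∣ - p l ∣    ≡⟨ 0≤p⇒∣p∣≡p (neg-antimono-≤ (p-lo B)) ⟩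
    - p l        ≡⟨ +-identityˡ (- p l) ⟨
    0ℚ - p l     ≤⟨ +-monoˡ-≤ (- p l) (p-hi B) ⟩
    p u - p l
      ≡⟨ solve 2 (λ l d → let v = l :+ d in
           (v :* (v :* (v :* con 1ℚ)) :- (v :* (v :* con 1ℚ) :+ v :+ con 1ℚ)) :-
           (l :* (l :* (l :* con 1ℚ)) :- (l :* (l :* con 1ℚ) :+ l :+ con 1ℚ)) :=
           (v :* v :+ v :* l :+ l :* l :- (v :+ l :+ con 1ℚ)) :* d) refl l d ⟩
    (u * u + u * l + l * l - (u + l + 1ℚ)) * d
      ≤⟨ *-monoʳ-≤-nonNeg d {{nonNegative (0≤h k)}} (+-mono-≤
          (+-mono-≤ (+-mono-≤ (*-mono 0≤u 0≤2 u≤2 u≤2) (*-mono 0≤u 0≤2 u≤2 l≤2)) (*-mono 0≤l 0≤2 l≤2 l≤2))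
          (neg-antimono-≤ (+-mono-≤ (+-mono-≤ 0≤u 0≤l) (nonNegative⁻¹ 1ℚ)))) ⟩
    (12ℚ - (0ℚ + 0ℚ + 0ℚ)) * d   ≡⟨⟩
    12ℚ * d      ∎
    where
    open ≤-Reasoning
    B = bracket k
    l = lo B
    d = h k
    u = l + d
    0≤l = ≤-trans (nonNegative⁻¹ 1ℚ) (1≤lo B)
    0≤u = ≤-trans 0≤l (x≤x+h k l)
    u≤2 = hi≤2 B
    l≤2 = ≤-trans (x≤x+h k l) u≤2

  h-antitone : ∀ {m n} → m ℕ.≤ n → h n ≤ h m
  h-antitone {m} {n} m≤n = subst (λ k → h k ≤ h m) (ℕ.m∸n+n≡m m≤n) (go (n ℕ.∸ m))
    where
    go : ∀ j → h (j ℕ.+ m) ≤ h m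
    go zero    = ≤-refl
    go (suc j) = ≤-trans (subst (h (suc j ℕ.+ m) ≤_) (h+h (j ℕ.+ m)) (x≤x+h (suc j ℕ.+ m) _)) (go j)

  p-root→0 : ∀ ε → 0ℚ < ε → ∃ λ N → ∀ n → N ℕ.≤ n → ∣ p (root n) ∣ < ε
  p-root→0 ε 0<ε = N , λ n N≤n → ≤-<-trans (p-small n)
    (≤-<-trans (*-monoˡ-≤-nonNeg 12ℚ (h-antitone N≤n))
      (subst (12ℚ * h N <_) 12δ≡ε (*-monoʳ-<-pos 12ℚ hN<δ)))
    where
    δ = (1/ 12ℚ) * ε
    0<δ : 0ℚ < δ
    0<δ = subst (_< δ) (*-zeroʳ (1/ 12ℚ)) (*-monoʳ-<-pos (1/ 12ℚ) 0<ε)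
    12δ≡ε : 12ℚ * δ ≡ ε
    12δ≡ε = trans (sym (*-assoc 12ℚ (1/ 12ℚ) ε)) (*-identityˡ ε)
    N = proj₁ (h→0 δ 0<δ)
    hN<δ = proj₂ (h→0 δ 0<δ)

record ℝ : Set where
  constructor mkℝ
  field
    seq    : ℕ → ℚ
    cauchy : ∀ ε → 0ℚ ℚ.< ε →
             ∃ λ N → ∀ m n → N ℕ.≤ m → N ℕ.≤ n → ℚ.∣ seq m ℚ.- seq n ∣ ℚ.< ε

open ℝ public

infix 4 _≃_ _≤_ _<_

_≃_ : ℝ → ℝ → Set
x ≃ y = ∀ ε → 0ℚ ℚ.< ε →
        ∃ λ N → ∀ n → N ℕ.≤ n → ℚ.∣ seq x n ℚ.- seq y n ∣ ℚ.< ε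

_≤_ : ℝ → ℝ → Set
x ≤ y = ∀ ε → 0ℚ ℚ.< ε →
        ∃ λ N → ∀ n → N ℕ.≤ n → seq x n ℚ.≤ seq y n ℚ.+ ε

_<_ : ℝ → ℝ → Set
x < y = ∃ λ ε → 0ℚ ℚ.< ε ×
        ∃ λ N → ∀ n → N ℕ.≤ n → seq x n ℚ.+ ε ℚ.≤ seq y n

fromℚ : ℚ → ℝ
fromℚ q = mkℝ (λ _ → q) λ ε 0<ε → 0 , λ _ _ _ _ →
  subst (ℚ._< ε) (sym (cong ℚ.∣_∣ (ℚ.+-inverseʳ q))) 0<ε

fromℤ : ℤ → ℝ
fromℤ z = fromℚ (z ℚ./ 1)

private
  distance-+ : ∀ a b c d →
    ℚ.∣ (a ℚ.+ b) ℚ.- (c ℚ.+ d) ∣ ℚ.≤ ℚ.∣ a ℚ.- c ∣ ℚ.+ ℚ.∣ b ℚ.- d ∣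
  distance-+ a b c d = subst (λ q → ℚ.∣ q ∣ ℚ.≤ ℚ.∣ a ℚ.- c ∣ ℚ.+ ℚ.∣ b ℚ.- d ∣)
    (solve 4 (λ a b c d → (a :- c) :+ (b :- d) := (a :+ b) :- (c :+ d)) refl a b c d)
    (ℚ.∣p+q∣≤∣p∣+∣q∣ (a ℚ.- c) (b ℚ.- d))
    where open +-*-Solver

  distance-* : ∀ a b c d →
    ℚ.∣ (a ℚ.* b) ℚ.- (c ℚ.* d) ∣ ℚ.≤
    ℚ.∣ a ∣ ℚ.* ℚ.∣ b ℚ.- d ∣ ℚ.+ ℚ.∣ d ∣ ℚ.* ℚ.∣ a ℚ.- c ∣
  distance-* a b c d = begin
    ℚ.∣ (a ℚ.* b) ℚ.- (c ℚ.* d) ∣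
      ≡⟨ cong ℚ.∣_∣ (solve 4 (λ a b c d → (a :* b) :- (c :* d) := a :* (b :- d) :+ d :* (a :- c)) refl a b c d) ⟩
    ℚ.∣ a ℚ.* (b ℚ.- d) ℚ.+ d ℚ.* (a ℚ.- c) ∣
      ≤⟨ ℚ.∣p+q∣≤∣p∣+∣q∣ (a ℚ.* (b ℚ.- d)) (d ℚ.* (a ℚ.- c)) ⟩
    ℚ.∣ a ℚ.* (b ℚ.- d) ∣ ℚ.+ ℚ.∣ d ℚ.* (a ℚ.- c) ∣
      ≡⟨ cong₂ ℚ._+_ (ℚ.∣p*q∣≡∣p∣*∣q∣ a (b ℚ.- d)) (ℚ.∣p*q∣≡∣p∣*∣q∣ d (a ℚ.- c)) ⟩
    ℚ.∣ a ∣ ℚ.* ℚ.∣ b ℚ.- d ∣ ℚ.+ ℚ.∣ d ∣ ℚ.* ℚ.∣ a ℚ.- c ∣ ∎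
    where open +-*-Solver
          open ℚ.≤-Reasoning

  half : ∀ ε → 0ℚ ℚ.< ε → ∃ λ δ → 0ℚ ℚ.< δ × δ ℚ.+ δ ≡ ε
  half ε 0<ε = ℚ.½ ℚ.* ε
    , subst (ℚ._< ℚ.½ ℚ.* ε) (ℚ.*-zeroʳ ℚ.½) (ℚ.*-monoʳ-<-pos ℚ.½ 0<ε)
    , trans (sym (ℚ.*-distribʳ-+ ε ℚ.½ ℚ.½)) (ℚ.*-identityˡ ε)

  split : ∀ b ε → 0ℚ ℚ.< b → 0ℚ ℚ.< ε → ∃ λ δ → 0ℚ ℚ.< δ × b ℚ.* δ ≡ ε
  split b ε 0<b 0<ε = (ℚ.1/ b) ℚ.* ε
    , subst (ℚ._< (ℚ.1/ b) ℚ.* ε) (ℚ.*-zeroʳ (ℚ.1/ b)) (ℚ.*-monoʳ-<-pos (ℚ.1/ b) 0<ε)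
    , trans (sym (ℚ.*-assoc b (ℚ.1/ b) ε))
        (trans (cong (ℚ._* ε) (ℚ.*-inverseʳ b)) (ℚ.*-identityˡ ε))
    where instance
      b>0 : ℚ.Positive b
      b>0 = ℚ.positive 0<b
      b≢0 : ℚ.NonZero b
      b≢0 = ℚ.pos⇒nonZero b
      1/b>0 : ℚ.Positive (ℚ.1/ b)
      1/b>0 = ℚ.1/pos⇒pos b

  bounded : ∀ x → ∃ λ b → 0ℚ ℚ.< b × ∃ λ N → ∀ n → N ℕ.≤ n → ℚ.∣ seq x n ∣ ℚ.≤ b
  bounded x with cauchy x 1ℚ (ℚ.positive⁻¹ 1ℚ)
  ... | N , close = 1ℚ ℚ.+ ℚ.∣ seq x N ∣
    , ℚ.+-mono-<-≤ (ℚ.positive⁻¹ 1ℚ) (ℚ.0≤∣p∣ (seq x N))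
    , N , λ n N≤n → begin
      ℚ.∣ seq x n ∣
        ≡⟨ cong ℚ.∣_∣ (solve 2 (λ a b → a := (a :- b) :+ b) refl (seq x n) (seq x N)) ⟩
      ℚ.∣ (seq x n ℚ.- seq x N) ℚ.+ seq x N ∣
        ≤⟨ ℚ.∣p+q∣≤∣p∣+∣q∣ (seq x n ℚ.- seq x N) (seq x N) ⟩
      ℚ.∣ seq x n ℚ.- seq x N ∣ ℚ.+ ℚ.∣ seq x N ∣
        ≤⟨ ℚ.+-monoˡ-≤ ℚ.∣ seq x N ∣ (ℚ.<⇒≤ (close n N N≤n ℕ.≤-refl)) ⟩
      1ℚ ℚ.+ ℚ.∣ seq x N ∣ ∎
    where open +-*-Solver
          open ℚ.≤-Reasoning

infixl 6 _+_
infixl 7 _*_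
infixr 8 _^_

_+_ : ℝ → ℝ → ℝ
x + y = mkℝ (λ n → seq x n ℚ.+ seq y n) λ ε 0<ε →
  let δ , 0<δ , δ+δ≡ε = half ε 0<ε
      M , closeˣ = cauchy x δ 0<δ
      N , closeʸ = cauchy y δ 0<δ
  in M ⊔ N , λ m n p q → ℚ.≤-<-trans
    (distance-+ (seq x m) (seq y m) (seq x n) (seq y n))
    (subst (_ ℚ.<_) δ+δ≡ε (ℚ.+-mono-<
      (closeˣ m n (ℕ.m⊔n≤o⇒m≤o M N p) (ℕ.m⊔n≤o⇒m≤o M N q))
      (closeʸ m n (ℕ.m⊔n≤o⇒n≤o M N p) (ℕ.m⊔n≤o⇒n≤o M N q))))

_*_ : ℝ → ℝ → ℝ
x * y = mkℝ (λ n → seq x n ℚ.* seq y n) λ ε 0<ε →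
  let b , 0<b , K , x≤b = bounded x
      c , 0<c , L , y≤c = bounded y
      δ , 0<δ , [b+c]δ≡ε = split (b ℚ.+ c) ε (ℚ.+-mono-< 0<b 0<c) 0<ε
      M , closeˣ = cauchy x δ 0<δ
      N , closeʸ = cauchy y δ 0<δ
  in (K ⊔ L) ⊔ (M ⊔ N) , λ m n p q →
    let p₁ = ℕ.m⊔n≤o⇒m≤o (K ⊔ L) (M ⊔ N) p
        p₂ = ℕ.m⊔n≤o⇒n≤o (K ⊔ L) (M ⊔ N) p
        q₁ = ℕ.m⊔n≤o⇒m≤o (K ⊔ L) (M ⊔ N) q
        q₂ = ℕ.m⊔n≤o⇒n≤o (K ⊔ L) (M ⊔ N) q
    in ℚ.≤-<-trans
      (distance-* (seq x m) (seq y m) (seq x n) (seq y n))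
      (subst (_ ℚ.<_) (trans (sym (ℚ.*-distribʳ-+ δ b c)) [b+c]δ≡ε) (ℚ.+-mono-<
        (scale (seq x m) b _ δ 0<b (x≤b m (ℕ.m⊔n≤o⇒m≤o K L p₁))
          (closeʸ m n (ℕ.m⊔n≤o⇒n≤o M N p₂) (ℕ.m⊔n≤o⇒n≤o M N q₂)))
        (scale (seq y n) c _ δ 0<c (y≤c n (ℕ.m⊔n≤o⇒n≤o K L q₁))
          (closeˣ m n (ℕ.m⊔n≤o⇒m≤o M N p₂) (ℕ.m⊔n≤o⇒m≤o M N q₂)))))
  where
    scale : ∀ u b r δ → 0ℚ ℚ.< b → ℚ.∣ u ∣ ℚ.≤ b → ℚ.∣ r ∣ ℚ.< δ →
            ℚ.∣ u ∣ ℚ.* ℚ.∣ r ∣ ℚ.< b ℚ.* δ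
    scale u b r δ 0<b u≤b r<δ = ℚ.≤-<-trans
      (ℚ.*-monoʳ-≤-nonNeg ℚ.∣ r ∣ {{ℚ.∣-∣-nonNeg r}} u≤b)
      (ℚ.*-monoʳ-<-pos b {{ℚ.positive 0<b}} r<δ)

_^_ : ℝ → ℕ → ℝ
x ^ zero  = fromℚ 1ℚ
x ^ suc n = x * x ^ n

-- The floor of a real is not a computable function of it, so it is given by its graph.
infix 4 ⌊_⌋≡_

⌊_⌋≡_ : ℝ → ℤ → Set
⌊ x ⌋≡ f = fromℤ f ≤ x × x < fromℤ (f ℤ.+ + 1)

IsTribonacciConstant : ℝ → Set
IsTribonacciConstant ψ = ψ ^ 3 ≃ ψ ^ 2 + ψ + fromℚ 1ℚ

∃-tribonacciConstant : ∃ IsTribonacciConstant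
∃-tribonacciConstant = mkℝ root root-cauchy , p-root→0
  where open Bisection

data Letter : Set where
  a b c : Letter

_≟_ : DecidableEquality Letter
a ≟ a = yes refl
a ≟ b = no λ ()
a ≟ c = no λ ()
b ≟ a = no λ ()
b ≟ b = yes refl
b ≟ c = no λ ()
c ≟ a = no λ ()
c ≟ b = no λ ()
c ≟ c = yes refl

τ : Letter → List Letter
τ a = a ∷ b ∷ []
τ b = a ∷ c ∷ []
τ c = a ∷ []

τ* : List Letter → List Letter
τ* = concatMap τ

τ^_[a] : ℕ → List Letter
τ^ zero  [a] = [ a ]
τ^ suc k [a] = τ* (τ^ k [a])

private
  -- τ^ suc k [a] extends τ^ k [a] by the image of b under τᵏ.
  tail : ℕ → List Letter
  tail zero    = [ b ]
  tail (suc k) = τ* (tail k)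

  extends : ∀ k → τ^ suc k [a] ≡ τ^ k [a] ++ tail k
  extends zero    = refl
  extends (suc k) = trans (cong τ* (extends k)) (concatMap-++ τ (τ^ k [a]) (tail k))

  τ-nonempty : ∀ x → 1 ℕ.≤ length (τ x)
  τ-nonempty a = ℕ.s≤s ℕ.z≤n
  τ-nonempty b = ℕ.s≤s ℕ.z≤n
  τ-nonempty c = ℕ.s≤s ℕ.z≤n

  length-τ* : ∀ w → length w ℕ.≤ length (τ* w)
  length-τ* []      = ℕ.z≤n
  length-τ* (x ∷ w) = subst (suc (length w) ℕ.≤_) (sym (length-++ (τ x)))
    (ℕ.+-mono-≤ (τ-nonempty x) (length-τ* w))

  tail-nonempty : ∀ k → 1 ℕ.≤ length (tail k)
  tail-nonempty zero    = ℕ.≤-refl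
  tail-nonempty (suc k) = ℕ.≤-trans (tail-nonempty k) (length-τ* (tail k))

length-τ^ : ∀ k → k ℕ.< length (τ^ k [a])
length-τ^ zero    = ℕ.≤-refl
length-τ^ (suc k) = begin
  2 ℕ.+ k                                ≡⟨ ℕ.+-comm 1 (suc k) ⟩
  suc k ℕ.+ 1                            ≤⟨ ℕ.+-mono-≤ (length-τ^ k) (tail-nonempty k) ⟩
  length (τ^ k [a]) ℕ.+ length (tail k)  ≡⟨ length-++ (τ^ k [a]) ⟨
  length (τ^ k [a] ++ tail k)            ≡⟨ cong length (extends k) ⟨
  length (τ^ suc k [a])                  ∎
  where open ℕ.≤-Reasoning

-- 𝐓 i is the letter tᵢ₊₁ of the infinite word; the words τ^ k [a] are prefixes of one another.
𝐓 : ℕ → Letter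
𝐓 i = lookup (τ^ i [a]) (fromℕ< (length-τ^ i))

infix 4 _isPrefixOf_

_isPrefixOf_ : List Letter → (ℕ → Letter) → Set
w isPrefixOf t = w ≡ applyUpTo t (length w)

private
  lookup-++ : ∀ (v w : List Letter) i .(p : i ℕ.< length v) .(q : i ℕ.< length (v ++ w)) →
              lookup (v ++ w) (fromℕ< q) ≡ lookup v (fromℕ< p)
  lookup-++ (x ∷ v) w zero    p q = refl
  lookup-++ (x ∷ v) w (suc i) p q = lookup-++ v w i (ℕ.s<s⁻¹ p) (ℕ.s<s⁻¹ q)

  lookup-cong : ∀ {v w : List Letter} → v ≡ w → ∀ i .(p : i ℕ.< length v) .(q : i ℕ.< length w) →
                lookup v (fromℕ< p) ≡ lookup w (fromℕ< q)
  lookup-cong refl i p q = refl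

  grow : ∀ j k → ∃ λ w → τ^ j ℕ.+ k [a] ≡ τ^ k [a] ++ w
  grow zero    k = [] , sym (++-identityʳ _)
  grow (suc j) k with grow j k
  ... | w , eq = w ++ tail (j ℕ.+ k) , trans (extends (j ℕ.+ k))
    (trans (cong (_++ tail (j ℕ.+ k)) eq) (++-assoc (τ^ k [a]) w (tail (j ℕ.+ k))))

  lookup-grow : ∀ j k i .(p : i ℕ.< length (τ^ k [a])) .(q : i ℕ.< length (τ^ j ℕ.+ k [a])) →
                lookup (τ^ j ℕ.+ k [a]) (fromℕ< q) ≡ lookup (τ^ k [a]) (fromℕ< p)
  lookup-grow j k i p q with grow j k
  ... | w , eq = trans
    (lookup-cong eq i q (subst (i ℕ.<_) (cong length eq) q))
    (lookup-++ (τ^ k [a]) w i p _)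

  lookup-𝐓 : ∀ k i .(p : i ℕ.< length (τ^ k [a])) → lookup (τ^ k [a]) (fromℕ< p) ≡ 𝐓 i
  lookup-𝐓 k i p = trans
    (sym (lookup-grow i k i p (subst (λ m → i ℕ.< length (τ^ m [a])) (ℕ.+-comm k i) r)))
    (trans (lookup-cong (cong τ^_[a] (ℕ.+-comm i k)) i _ r)
      (lookup-grow k i i (length-τ^ i) r))
    where
    r : i ℕ.< length (τ^ k ℕ.+ i [a])
    r = ℕ.≤-trans (ℕ.s≤s (ℕ.m≤n+m i k)) (length-τ^ (k ℕ.+ i))

  prefix-ext : ∀ w t → (∀ i .(p : i ℕ.< length w) → lookup w (fromℕ< p) ≡ t i) → w isPrefixOf t
  prefix-ext []      t eq = refl
  prefix-ext (x ∷ w) t eq = cong₂ _∷_ (eq 0 (ℕ.s≤s ℕ.z≤n))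
    (prefix-ext w (λ i → t (suc i)) λ i p → eq (suc i) (ℕ.s≤s p))

  applyUpTo-+ : ∀ (t : ℕ → Letter) m n →
                applyUpTo t (m ℕ.+ n) ≡ applyUpTo t m ++ applyUpTo (λ i → t (m ℕ.+ i)) n
  applyUpTo-+ t zero    n = refl
  applyUpTo-+ t (suc m) n = cong (t 0 ∷_) (applyUpTo-+ (λ i → t (suc i)) m n)

  length-applyUpTo : ∀ (t : ℕ → Letter) n → length (applyUpTo t n) ≡ n
  length-applyUpTo t zero    = refl
  length-applyUpTo t (suc n) = cong suc (length-applyUpTo (λ i → t (suc i)) n)

  prefix-++ : ∀ v w {t} → v ++ w isPrefixOf t → v isPrefixOf t
  prefix-++ []      w eq = refl
  prefix-++ (x ∷ v) w eq = cong₂ _∷_ (∷-injectiveˡ eq) (prefix-++ v w (∷-injectiveʳ eq))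

τ^-prefix : ∀ k → τ^ k [a] isPrefixOf 𝐓
τ^-prefix k = prefix-ext (τ^ k [a]) 𝐓 (lookup-𝐓 k)

-- τ(𝐓) = 𝐓: the images under τ of the prefixes of 𝐓 are prefixes of 𝐓.
𝐓-fixed : ∀ n → τ* (applyUpTo 𝐓 n) isPrefixOf 𝐓
𝐓-fixed n = prefix-++ (τ* (applyUpTo 𝐓 n)) (τ* rest)
  (subst (_isPrefixOf 𝐓) eq (τ^-prefix (suc n)))
  where
  n≤ = ℕ.<⇒≤ (length-τ^ n)
  rest = applyUpTo (λ i → 𝐓 (n ℕ.+ i)) (length (τ^ n [a]) ℕ.∸ n)
  eq : τ* (τ^ n [a]) ≡ τ* (applyUpTo 𝐓 n) ++ τ* rest
  eq = trans
    (cong τ* (trans (τ^-prefix n) (trans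
      (cong (applyUpTo 𝐓) (sym (ℕ.m+[n∸m]≡n n≤)))
      (applyUpTo-+ 𝐓 n _))))
    (concatMap-++ τ (applyUpTo 𝐓 n) rest)

count : Letter → List Letter → ℕ
count x w = length (filter (_≟ x) w)

-- The n-th occurrence of x in t₁ t₂ t₃ ⋯ (with tᵢ₊₁ = t i) has index j.
-- By convention the 0-th occurrence has index 0.
IsOccurrence : (ℕ → Letter) → Letter → ℕ → ℕ → Set
IsOccurrence t x zero    j       = j ≡ 0
IsOccurrence t x (suc n) zero    = ⊥
IsOccurrence t x (suc n) (suc i) = t i ≡ x × count x (applyUpTo t i) ≡ n

private
  count-++ : ∀ x v w → count x (v ++ w) ≡ count x v ℕ.+ count x w
  count-++ x v w = trans (cong length (filter-++ (_≟ x) v w)) (length-++ (filter (_≟ x) v))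

  count-τ³ : ∀ x y → 1 ℕ.≤ count x (τ* (τ* (τ y)))
  count-τ³ a a = ℕ.s≤s ℕ.z≤n
  count-τ³ a b = ℕ.s≤s ℕ.z≤n
  count-τ³ a c = ℕ.s≤s ℕ.z≤n
  count-τ³ b a = ℕ.s≤s ℕ.z≤n
  count-τ³ b b = ℕ.s≤s ℕ.z≤n
  count-τ³ b c = ℕ.s≤s ℕ.z≤n
  count-τ³ c a = ℕ.s≤s ℕ.z≤n
  count-τ³ c b = ℕ.s≤s ℕ.z≤n
  count-τ³ c c = ℕ.s≤s ℕ.z≤n

  τ*³-∷ : ∀ y w → τ* (τ* (τ* (y ∷ w))) ≡ τ* (τ* (τ y)) ++ τ* (τ* (τ* w))
  τ*³-∷ y w = trans (cong τ* (concatMap-++ τ (τ y) (τ* w)))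
    (concatMap-++ τ (τ* (τ y)) (τ* (τ* w)))

  count-τ*³ : ∀ x w → length w ℕ.≤ count x (τ* (τ* (τ* w)))
  count-τ*³ x []      = ℕ.z≤n
  count-τ*³ x (y ∷ w) = begin
    1 ℕ.+ length w
      ≤⟨ ℕ.+-mono-≤ (count-τ³ x y) (count-τ*³ x w) ⟩
    count x (τ* (τ* (τ y))) ℕ.+ count x (τ* (τ* (τ* w)))
      ≡⟨ count-++ x (τ* (τ* (τ y))) (τ* (τ* (τ* w))) ⟨
    count x (τ* (τ* (τ y)) ++ τ* (τ* (τ* w)))
      ≡⟨ cong (count x) (τ*³-∷ y w) ⟨
    count x (τ* (τ* (τ* (y ∷ w)))) ∎
    where open ℕ.≤-Reasoning

  count-step : ∀ t x m → count x (applyUpTo t (suc m)) ≡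
               count x (applyUpTo t m) ℕ.+ count x [ t m ]
  count-step t x m = trans (cong (count x) (sym (applyUpTo-∷ʳ t m)))
    (count-++ x (applyUpTo t m) [ t m ])

  search : ∀ t x n m → n ℕ.< count x (applyUpTo t m) → ∃ (IsOccurrence t x (suc n))
  search t x n (suc m) n<c with n ℕ.<? count x (applyUpTo t m) | t m ≟ x | count-step t x m
  ... | yes n<c′ | _        | _ = search t x n m n<c′
  ... | no  n≮c′ | no tm≢x  | step = contradiction
    (subst (n ℕ.<_) (trans step (ℕ.+-identityʳ _)) n<c) n≮c′
  ... | no  n≮c′ | yes tm≡x | step = suc m , tm≡x , ℕ.≤-antisym (ℕ.≮⇒≥ n≮c′)
    (ℕ.s≤s⁻¹ (subst (n ℕ.<_) (trans step (ℕ.+-comm _ 1)) n<c))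

occurrence : ∀ x n → ∃ (IsOccurrence 𝐓 x n)
occurrence x zero    = 0 , refl
occurrence x (suc n) = search 𝐓 x n (length (τ^ 3 ℕ.+ n [a]))
  (ℕ.<-≤-trans (length-τ^ n)
    (subst (length (τ^ n [a]) ℕ.≤_) (cong (count x) (τ^-prefix (3 ℕ.+ n)))
      (count-τ*³ x (τ^ n [a]))))

A B C : ℕ → ℕ
A n = proj₁ (occurrence a n)
B n = proj₁ (occurrence b n)
C n = proj₁ (occurrence c n)

{-# OPTIONS --safe #-}
module Submission where

-- Write T n for the prefix of length n of the Tribonacci word 𝐓.  Since τ(𝐓) = 𝐓, and since the blocks
-- τ(x), τ²(x), τ³(x) begin with a, ab, abac and contain exactly one a, b, c respectively, the n-th a, b, c
-- of 𝐓 are found in the n-th block (occurrence-τ^):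
--   A (n+1) = |τ(T n)| + 1,   B (n+1) = |τ²(T n)| + 2,   C (n+1) = |τ³(T n)| + 4.
--
-- For a number q let D i (w) = |τⁱ(w)| - q |τⁱ(w)|ₐ, the discrepancy of the letter a in τⁱ(w).  When q is
-- the root ψ of p(x) = x³ - x² - x - 1, all the forms D i lie in the plane of linear forms in the letter
-- counts of w that vanish on the frequency vector of 𝐓, and letter by letter one checks, with γ = q² - q - 1,
--   |τ(w)|  - q  |w| = D 1 (w),
--   |τ²(w)| - q² |w| = D 1 (w) - γ D 0 (w),
--   |τ³(w)| - q³ |w| = 2 D 1 (w) - γ D 0 (w).
-- So the theorem follows from good enough bounds for D 0 and D 1 on the prefixes of 𝐓.
--
-- Every nonempty prefix is τ(T m) or τ(T m) a for a shorter prefix T m (T-parse), so that D i at this prefix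
-- is D (i+1) at T m, plus possibly the constant D i (a).  Bounds for D 1, …, D 6 at T m therefore give bounds
-- for D 0, …, D 5 at the longer prefix.  To close the induction, D 6 is expressed by D 3 and D 2 with the
-- small coefficients 4 - 2q ≈ 0.32 and -(2γ - 1) ≈ -0.09 (D₆-relation); the induction then runs
-- with the explicit constants of the tables L and U (T-balanced).
--
-- Only rational q occur: a real ψ is a Cauchy sequence of rationals q with p(q) → 0.  For such q the
-- identities above hold up to a multiple of p(q) that is bounded in terms of n.  For fixed n and q far enough
-- in the sequence these errors are at most 1/1000 (tolerance), and the estimates have room for them.
-- Bounds with a margin for all late q yield the bounds for the floor (floor-bounds).

open import Data.Integer.Base as ℤ using (ℤ; +_)
import Data.Integer.Properties as ℤ
open import Data.List.Base using (List; []; _∷_; [_]; _++_; length; filter; applyUpTo)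
open import Data.List.Properties using (∷-injectiveˡ; ∷-injectiveʳ; ++-assoc; ++-identityʳ; length-++; length-filter; filter-++; applyUpTo-∷ʳ; concatMap-++; length-applyUpTo)
open import Data.Nat.Base as ℕ using (ℕ; zero; suc; z≤n; s≤s)
open import Data.Nat.Induction using (<-rec)
import Data.Nat.Properties as ℕ
open import Data.Product.Base using (∃; _×_; _,_; proj₁; proj₂)
open import Data.Sum.Base using (_⊎_; inj₁; inj₂; [_,_]′)
open import Defs using (ℝ; seq; fromℤ; ⌊_⌋≡_; IsTribonacciConstant; A; B; C; Letter; a; b; c; τ; τ*; 𝐓; 𝐓-fixed; _isPrefixOf_; count; IsOccurrence; _≟_; occurrence)
open import Relation.Binary.Definitions using (tri<; tri≈; tri>)
open import Relation.Binary.PropositionalEquality using (_≡_; refl; sym; trans; cong; cong₂; subst; subst₂; module ≡-Reasoning)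
open import Relation.Nullary using (contradiction)
open import Relation.Nullary.Decidable using (from-yes; _×-dec_)

-- Prefixes of the Tribonacci word

-- T n is the prefix t₁ ⋯ tₙ; the letter that follows it is 𝐓 n.
T : ℕ → List Letter
T = applyUpTo 𝐓

length-T : ∀ n → length (T n) ≡ n
length-T = length-applyUpTo 𝐓

T-suc : ∀ n → T (suc n) ≡ T n ++ [ 𝐓 n ]
T-suc n = sym (applyUpTo-∷ʳ 𝐓 n)

-- The i-th iterate of τ on words.  The innermost application is split off, so that τ^ (suc i) w and
-- τ^ i (τ* w) are the same by definition.
τ^ : ℕ → List Letter → List Letter
τ^ zero    w = w
τ^ (suc i) w = τ^ i (τ* w)

τ^-++ : ∀ i v w → τ^ i (v ++ w) ≡ τ^ i v ++ τ^ i w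
τ^-++ zero    v w = refl
τ^-++ (suc i) v w = trans (cong (τ^ i) (concatMap-++ τ v w)) (τ^-++ i (τ* v) (τ* w))

τ^-isPrefix : ∀ i w → w isPrefixOf 𝐓 → τ^ i w isPrefixOf 𝐓
τ^-isPrefix zero    w w⊑𝐓 = w⊑𝐓
τ^-isPrefix (suc i) w w⊑𝐓 = τ^-isPrefix i (τ* w)
  (subst (λ v → τ* v isPrefixOf 𝐓) (sym w⊑𝐓) (𝐓-fixed (length w)))

T-isPrefix : ∀ n → T n isPrefixOf 𝐓
T-isPrefix n = sym (cong T (length-T n))

τ^-T-isPrefix : ∀ i n → (τ^ i (T n) ++ τ^ i [ 𝐓 n ]) isPrefixOf 𝐓
τ^-T-isPrefix i n = subst (_isPrefixOf 𝐓) (trans (cong (τ^ i) (T-suc n)) (τ^-++ i (T n) [ 𝐓 n ]))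
  (τ^-isPrefix i (T (suc n)) (T-isPrefix (suc n)))

isPrefix-++ : ∀ v w {t} → (v ++ w) isPrefixOf t → v isPrefixOf t
isPrefix-++ []      w vw⊑t = refl
isPrefix-++ (x ∷ v) w vw⊑t = cong₂ _∷_ (∷-injectiveˡ vw⊑t) (isPrefix-++ v w (∷-injectiveʳ vw⊑t))

isPrefix-next : ∀ v x w {t} → (v ++ x ∷ w) isPrefixOf t → t (length v) ≡ x
isPrefix-next []      x w vxw⊑t = sym (∷-injectiveˡ vxw⊑t)
isPrefix-next (y ∷ v) x w vxw⊑t = isPrefix-next v x w (∷-injectiveʳ vxw⊑t)

T-unique : ∀ {v} n → v isPrefixOf 𝐓 → length v ≡ n → T n ≡ v
T-unique n v⊑𝐓 ∣v∣≡n = sym (trans v⊑𝐓 (cong T ∣v∣≡n))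

-- Positions of the letters

count-++ : ∀ x v w → count x (v ++ w) ≡ count x v ℕ.+ count x w
count-++ x v w = trans (cong length (filter-++ (_≟ x) v w)) (length-++ (filter (_≟ x) v))

count-self : ∀ x → count x [ x ] ≡ 1
count-self a = refl
count-self b = refl
count-self c = refl

applyUpTo-grow : ∀ (t : ℕ → Letter) {m n} → m ℕ.≤ n → ∃ λ w → applyUpTo t n ≡ applyUpTo t m ++ w
applyUpTo-grow t z≤n       = _ , refl
applyUpTo-grow t (s≤s m≤n) with applyUpTo-grow (λ i → t (suc i)) m≤n
... | w , eq = w , cong (t 0 ∷_) eq

count-< : ∀ t x {i j} → t i ≡ x → i ℕ.< j → count x (applyUpTo t i) ℕ.< count x (applyUpTo t j)
count-< t x {i} {j} refl i<j with applyUpTo-grow t i<j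
... | w , eq = begin
  suc (count x (applyUpTo t i))                       ≡⟨ ℕ.+-comm 1 _ ⟩
  count x (applyUpTo t i) ℕ.+ 1                       ≡⟨ cong (count x (applyUpTo t i) ℕ.+_) (count-self x) ⟨
  count x (applyUpTo t i) ℕ.+ count x [ x ]           ≡⟨ count-++ x (applyUpTo t i) [ x ] ⟨
  count x (applyUpTo t i ++ [ x ])                    ≡⟨ cong (count x) (applyUpTo-∷ʳ t i) ⟩
  count x (applyUpTo t (suc i))                       ≤⟨ ℕ.m≤m+n _ (count x w) ⟩
  count x (applyUpTo t (suc i)) ℕ.+ count x w         ≡⟨ count-++ x (applyUpTo t (suc i)) w ⟨
  count x (applyUpTo t (suc i) ++ w)                  ≡⟨ cong (count x) eq ⟨
  count x (applyUpTo t j)                             ∎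
  where open ℕ.≤-Reasoning

occurrence-unique : ∀ t x n {i j} → IsOccurrence t x n i → IsOccurrence t x n j → i ≡ j
occurrence-unique t x zero    refl refl = refl
occurrence-unique t x (suc n) {suc i} {suc j} (ti , ci) (tj , cj) with ℕ.<-cmp i j
... | tri< i<j _ _  = contradiction (trans ci (sym cj)) (ℕ.<⇒≢ (count-< t x ti i<j))
... | tri≈ _ refl _ = refl
... | tri> _ _ j<i  = contradiction (trans cj (sym ci)) (ℕ.<⇒≢ (count-< t x tj j<i))

occurrence-index : ∀ x v w → (v ++ x ∷ w) isPrefixOf 𝐓 →
  proj₁ (occurrence x (suc (count x v))) ≡ suc (length v)
occurrence-index x v w vxw⊑𝐓 = occurrence-unique 𝐓 x (suc (count x v))
  (proj₂ (occurrence x (suc (count x v))))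
  (isPrefix-next v x w vxw⊑𝐓 , cong (count x) (sym (isPrefix-++ v (x ∷ w) vxw⊑𝐓)))

count-a-τ* : ∀ w → count a (τ* w) ≡ length w
count-a-τ* []      = refl
count-a-τ* (a ∷ w) = cong suc (count-a-τ* w)
count-a-τ* (b ∷ w) = cong suc (count-a-τ* w)
count-a-τ* (c ∷ w) = cong suc (count-a-τ* w)

count-b-τ* : ∀ w → count b (τ* w) ≡ count a w
count-b-τ* []      = refl
count-b-τ* (a ∷ w) = cong suc (count-b-τ* w)
count-b-τ* (b ∷ w) = count-b-τ* w
count-b-τ* (c ∷ w) = count-b-τ* w

count-c-τ* : ∀ w → count c (τ* w) ≡ count b w
count-c-τ* []      = refl
count-c-τ* (a ∷ w) = count-c-τ* w
count-c-τ* (b ∷ w) = cong suc (count-c-τ* w)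
count-c-τ* (c ∷ w) = count-c-τ* w

-- If every block τⁱ(y) contains x exactly once, after the same word u, then the occurrence of x with
-- number n + 1 stands in the block of the letter 𝐓 n, right after τⁱ(T n) u.
occurrence-τ^ : ∀ x i u → count x u ≡ 0 → (∀ w → count x (τ^ i w) ≡ length w) →
  (∀ y → ∃ λ w → τ^ i [ y ] ≡ u ++ x ∷ w) →
  ∀ n → proj₁ (occurrence x (suc n)) ≡ suc (length (τ^ i (T n)) ℕ.+ length u)
occurrence-τ^ x i u u≡0 once starts n = begin
  proj₁ (occurrence x (suc n))             ≡⟨ cong (λ k → proj₁ (occurrence x (suc k))) count-v ⟨
  proj₁ (occurrence x (suc (count x v)))   ≡⟨ occurrence-index x v w vxw⊑𝐓 ⟩
  suc (length v)                           ≡⟨ cong suc (length-++ (τ^ i (T n))) ⟩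
  suc (length (τ^ i (T n)) ℕ.+ length u)   ∎
  where
  open ≡-Reasoning
  v = τ^ i (T n) ++ u
  w = proj₁ (starts (𝐓 n))
  vxw⊑𝐓 : (v ++ x ∷ w) isPrefixOf 𝐓
  vxw⊑𝐓 = subst (_isPrefixOf 𝐓)
    (trans (cong (τ^ i (T n) ++_) (proj₂ (starts (𝐓 n)))) (sym (++-assoc (τ^ i (T n)) u (x ∷ w))))
    (τ^-T-isPrefix i n)
  count-v : count x v ≡ n
  count-v = begin
    count x v                           ≡⟨ count-++ x (τ^ i (T n)) u ⟩
    count x (τ^ i (T n)) ℕ.+ count x u  ≡⟨ cong₂ ℕ._+_ (once (T n)) u≡0 ⟩
    length (T n) ℕ.+ 0                  ≡⟨ ℕ.+-identityʳ _ ⟩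
    length (T n)                        ≡⟨ length-T n ⟩
    n                                   ∎

A-suc : ∀ n → A (suc n) ≡ suc (length (τ^ 1 (T n)) ℕ.+ 0)
A-suc = occurrence-τ^ a 1 [] refl count-a-τ* λ { a → _ , refl ; b → _ , refl ; c → _ , refl }

B-suc : ∀ n → B (suc n) ≡ suc (length (τ^ 2 (T n)) ℕ.+ 1)
B-suc = occurrence-τ^ b 2 (a ∷ []) refl
  (λ w → trans (count-b-τ* (τ* w)) (count-a-τ* w))
  λ { a → _ , refl ; b → _ , refl ; c → _ , refl }

C-suc : ∀ n → C (suc n) ≡ suc (length (τ^ 3 (T n)) ℕ.+ 3)
C-suc = occurrence-τ^ c 3 (a ∷ b ∷ a ∷ []) refl
  (λ w → trans (count-c-τ* (τ* (τ* w))) (trans (count-b-τ* (τ* w)) (count-a-τ* w)))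
  λ { a → _ , refl ; b → _ , refl ; c → _ , refl }

-- Desubstitution of prefixes

-- The prefix T n is the τ-image of a shorter prefix, followed by d, which is empty or the first letter
-- of an incomplete block.
data Parse (n : ℕ) : Set where
  parse : ∀ m d → m ℕ.< n → T n ≡ τ* (T m) ++ d → d ≡ [] ⊎ d ≡ [ a ] → Parse n

private
  τ*-T-suc : ∀ m → τ* (T (suc m)) ≡ τ* (T m) ++ τ^ 1 [ 𝐓 m ]
  τ*-T-suc m = trans (cong τ* (T-suc m)) (τ^-++ 1 (T m) [ 𝐓 m ])

  τ-head : ∀ y → ∃ λ w → τ^ 1 [ y ] ≡ a ∷ w
  τ-head a = _ , refl
  τ-head b = _ , refl
  τ-head c = _ , refl

  open-block : ∀ n m → T n ≡ τ* (T m) → T (suc n) ≡ τ* (T m) ++ [ a ]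
  open-block n m eq with τ-head (𝐓 m)
  ... | w , τ𝐓 = T-unique (suc n)
    (isPrefix-++ (τ* (T m) ++ [ a ]) w (subst (_isPrefixOf 𝐓)
      (trans (cong (τ* (T m) ++_) τ𝐓) (sym (++-assoc (τ* (T m)) [ a ] w)))
      (τ^-T-isPrefix 1 m)))
    (trans (length-++ (τ* (T m))) (trans (ℕ.+-comm _ 1)
      (cong suc (trans (cong length (sym eq)) (length-T n)))))

  close-block : ∀ n m x → τ^ 1 [ 𝐓 m ] ≡ a ∷ x ∷ [] → T n ≡ τ* (T m) ++ [ a ] →
    T (suc n) ≡ τ* (T (suc m))
  close-block n m x τ𝐓 eq = T-unique (suc n)
    (τ^-isPrefix 1 (T (suc m)) (T-isPrefix (suc m)))
    (begin
      length (τ* (T (suc m)))                ≡⟨ cong length (trans (τ*-T-suc m) (cong (τ* (T m) ++_) τ𝐓)) ⟩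
      length (τ* (T m) ++ a ∷ x ∷ [])        ≡⟨ cong length (++-assoc (τ* (T m)) [ a ] [ x ]) ⟨
      length ((τ* (T m) ++ [ a ]) ++ [ x ])  ≡⟨ length-++ (τ* (T m) ++ [ a ]) ⟩
      length (τ* (T m) ++ [ a ]) ℕ.+ 1       ≡⟨ cong (λ w → length w ℕ.+ 1) eq ⟨
      length (T n) ℕ.+ 1                     ≡⟨ cong (ℕ._+ 1) (length-T n) ⟩
      n ℕ.+ 1                                ≡⟨ ℕ.+-comm n 1 ⟩
      suc n                                  ∎)
    where open ≡-Reasoning

T-parse : ∀ n → Parse (suc n)
T-parse zero    = parse 0 [ a ] (s≤s z≤n) refl (inj₂ refl)
T-parse (suc n) with T-parse n
... | parse m .[] m<n eq (inj₁ refl) =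
  parse m [ a ] (ℕ.m<n⇒m<1+n m<n) (open-block (suc n) m (trans eq (++-identityʳ _))) (inj₂ refl)
... | parse m .([ a ]) m<n eq (inj₂ refl) with 𝐓 m in tₘ
...   | a = parse (suc m) [] (s≤s m<n)
  (trans (close-block (suc n) m b (cong (λ y → τ^ 1 [ y ]) tₘ) eq) (sym (++-identityʳ _))) (inj₁ refl)
...   | b = parse (suc m) [] (s≤s m<n)
  (trans (close-block (suc n) m c (cong (λ y → τ^ 1 [ y ]) tₘ) eq) (sym (++-identityʳ _))) (inj₁ refl)
-- The block of c is complete after its only letter, so the next letter opens a new block.
...   | c = parse (suc m) [ a ] (s≤s m<n)
  (open-block (suc n) (suc m) (trans eq (sym (trans (τ*-T-suc m) (cong (λ y → τ* (T m) ++ τ^ 1 [ y ]) tₘ)))))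
  (inj₂ refl)

length-τ* : ∀ w → length (τ* w) ℕ.≤ length w ℕ.+ length w
length-τ* []      = z≤n
length-τ* (a ∷ w) = s≤s (subst (suc (length (τ* w)) ℕ.≤_) (sym (ℕ.+-suc (length w) (length w))) (s≤s (length-τ* w)))
length-τ* (b ∷ w) = s≤s (subst (suc (length (τ* w)) ℕ.≤_) (sym (ℕ.+-suc (length w) (length w))) (s≤s (length-τ* w)))
length-τ* (c ∷ w) = s≤s (ℕ.≤-trans (length-τ* w) (ℕ.+-monoʳ-≤ (length w) (ℕ.n≤1+n (length w))))

-- Rational estimates

module Estimates where
  open import Data.Rational.Base hiding (truncate)
  open import Data.Rational.Properties hiding (_≟_)
  open import Data.Rational.Solver using (module +-*-Solver)
  open import Data.Rational.Unnormalised.Base as ℚᵘ using (mkℚᵘ; *≡*; *<*)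
  import Data.Rational.Unnormalised.Properties as ℚᵘ
  open import Algebra.Properties.Group +-0-group using (identityˡ-unique) renaming (⁻¹-involutive to neg-involutive)
  open +-*-Solver

  -- Integers as rationals, by the same expression that underlies fromℤ.
  fromInt : ℤ → ℚ
  fromInt z = z / 1

  ι : ℕ → ℚ
  ι n = fromInt (+ n)

  -- n thousandths
  _‰ : ℕ → ℚ
  n ‰ = + n / 1000

  fromInt-+ : ∀ i j → fromInt (i ℤ.+ j) ≡ fromInt i + fromInt j
  fromInt-+ i j = toℚᵘ-injective (begin
    toℚᵘ (fromInt (i ℤ.+ j))                ≈⟨ toℚᵘ-fromℚᵘ (mkℚᵘ (i ℤ.+ j) 0) ⟩
    mkℚᵘ (i ℤ.+ j) 0                        ≈⟨ *≡* (cong (ℤ._* + 1) (cong₂ ℤ._+_ (ℤ.*-identityʳ i) (ℤ.*-identityʳ j))) ⟨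
    mkℚᵘ i 0 ℚᵘ.+ mkℚᵘ j 0                  ≈⟨ ℚᵘ.+-cong (toℚᵘ-fromℚᵘ (mkℚᵘ i 0)) (toℚᵘ-fromℚᵘ (mkℚᵘ j 0)) ⟨
    toℚᵘ (fromInt i) ℚᵘ.+ toℚᵘ (fromInt j)  ≈⟨ toℚᵘ-homo-+ (fromInt i) (fromInt j) ⟨
    toℚᵘ (fromInt i + fromInt j)            ∎)
    where open import Relation.Binary.Reasoning.Setoid ℚᵘ.≃-setoid

  fromInt-cancel-< : ∀ {i j} → fromInt i < fromInt j → i ℤ.< j
  fromInt-cancel-< {i} {j} i<j
    with ℚᵘ.<-respʳ-≃ (toℚᵘ-fromℚᵘ (mkℚᵘ j 0)) (ℚᵘ.<-respˡ-≃ (toℚᵘ-fromℚᵘ (mkℚᵘ i 0)) (toℚᵘ-mono-< i<j))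
  ... | *<* i·1<j·1 = subst₂ ℤ._<_ (ℤ.*-identityʳ i) (ℤ.*-identityʳ j) i·1<j·1

  ι-+ : ∀ m n → ι (m ℕ.+ n) ≡ ι m + ι n
  ι-+ m n = fromInt-+ (+ m) (+ n)

  0≤ι : ∀ n → 0ℚ ≤ ι n
  0≤ι n = nonNegative⁻¹ (ι n) {{normalize-nonNeg n 1}}

  ι-mono : ∀ {m n} → m ℕ.≤ n → ι m ≤ ι n
  ι-mono {m} {n} m≤n = subst₂ _≤_ (+-identityʳ (ι m))
    (trans (sym (ι-+ m (n ℕ.∸ m))) (cong ι (ℕ.m+[n∸m]≡n m≤n)))
    (+-monoʳ-≤ (ι m) (0≤ι (n ℕ.∸ m)))

  scale-≤ : ∀ α β x u → 0ℚ ≤ α → α ≤ β → x ≤ u → 0ℚ ≤ u → α * x ≤ β * u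
  scale-≤ α β x u 0≤α α≤β x≤u 0≤u = ≤-trans
    (*-monoˡ-≤-nonNeg α {{nonNegative 0≤α}} x≤u)
    (*-monoʳ-≤-nonNeg u {{nonNegative 0≤u}} α≤β)

  scale-≥ : ∀ α β x l → 0ℚ ≤ α → α ≤ β → l ≤ x → l ≤ 0ℚ → β * l ≤ α * x
  scale-≥ α β x l 0≤α α≤β l≤x l≤0 = ≤-trans
    (*-monoʳ-≤-nonPos l {{nonPositive l≤0}} α≤β)
    (*-monoˡ-≤-nonNeg α {{nonNegative 0≤α}} l≤x)

  ∣x∣≤y⇒x≤y : ∀ {x y} → ∣ x ∣ ≤ y → x ≤ y
  ∣x∣≤y⇒x≤y {x} {y} ∣x∣≤y with ∣p∣≡p∨∣p∣≡-p x
  ... | inj₁ eq = subst (_≤ y) eq ∣x∣≤y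
  ... | inj₂ eq = ≤-trans x≤0 (≤-trans (0≤∣p∣ x) ∣x∣≤y)
    where
    x≤0 : x ≤ 0ℚ
    x≤0 = subst (_≤ 0ℚ) (neg-involutive x) (neg-antimono-≤ (subst (0ℚ ≤_) eq (0≤∣p∣ x)))

  ∣x∣≤y⇒-x≤y : ∀ {x y} → ∣ x ∣ ≤ y → - x ≤ y
  ∣x∣≤y⇒-x≤y {x} {y} ∣x∣≤y = ∣x∣≤y⇒x≤y (subst (_≤ y) (sym (∣-p∣≡∣p∣ x)) ∣x∣≤y)

  ∣x∣≤y⇒-y≤x : ∀ {x y} → ∣ x ∣ ≤ y → - y ≤ x
  ∣x∣≤y⇒-y≤x {x} {y} ∣x∣≤y = subst (- y ≤_) (neg-involutive x) (neg-antimono-≤ (∣x∣≤y⇒-x≤y ∣x∣≤y))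

  0≤x*x : ∀ x → 0ℚ ≤ x * x
  0≤x*x x = [ (λ 0≤x → subst (_≤ x * x) (*-zeroʳ x) (*-monoˡ-≤-nonNeg x {{nonNegative 0≤x}} 0≤x))
            , (λ x≤0 → subst (_≤ x * x) (*-zeroʳ x) (*-monoˡ-≤-nonPos x {{nonPositive x≤0}} x≤0)) ]′
            (≤-total 0ℚ x)

  -- The powers are written as the powers of a real unfold.
  sq cube : ℚ → ℚ
  sq x = x * (x * 1ℚ)
  cube x = x * (x * (x * 1ℚ))

  0≤sq : ∀ x → 0ℚ ≤ sq x
  0≤sq x = subst (0ℚ ≤_) (cong (x *_) (sym (*-identityʳ x))) (0≤x*x x)

  sq-mono : ∀ {x y} → 0ℚ ≤ x → x ≤ y → sq x ≤ sq y
  sq-mono {x} {y} 0≤x x≤y = scale-≤ x y (x * 1ℚ) (y * 1ℚ) 0≤x x≤y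
    (*-monoʳ-≤-nonNeg 1ℚ x≤y) (subst (0ℚ ≤_) (sym (*-identityʳ y)) (≤-trans 0≤x x≤y))

  cube-mono : ∀ {x y} → 0ℚ ≤ x → x ≤ y → cube x ≤ cube y
  cube-mono {x} {y} 0≤x x≤y = scale-≤ x y (sq x) (sq y) 0≤x x≤y (sq-mono 0≤x x≤y) (0≤sq y)

  p : ℚ → ℚ
  p q = cube q - (sq q + q + 1ℚ)

  -- γ q = q² - q - 1, which is 1/q at the root of p.
  γ : ℚ → ℚ
  γ q = (q - 1ℚ) * q - 1ℚ

  poly-p poly-γ : ∀ {n} → Polynomial n → Polynomial n
  poly-p q = q :* (q :* (q :* con 1ℚ)) :- (q :* (q :* con 1ℚ) :+ q :+ con 1ℚ)
  poly-γ q = (q :- con 1ℚ) :* q :- con 1ℚ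

  -- Discrepancies and their linear relations

  record Additive (F : List Letter → ℚ) : Set where
    constructor mkAdditive
    field
      homo : ∀ v w → F (v ++ w) ≡ F v + F w

    homo-[] : F [] ≡ 0ℚ
    homo-[] = identityˡ-unique (F []) (F []) (sym (homo [] []))

  open Additive

  additive-ext : ∀ {F G} → Additive F → Additive G → (∀ x → F [ x ] ≡ G [ x ]) → ∀ w → F w ≡ G w
  additive-ext F+ G+ eq []      = trans (homo-[] F+) (sym (homo-[] G+))
  additive-ext {F} {G} F+ G+ eq (x ∷ w) = begin
    F (x ∷ w)      ≡⟨ homo F+ [ x ] w ⟩
    F [ x ] + F w  ≡⟨ cong₂ _+_ (eq x) (additive-ext F+ G+ eq w) ⟩
    G [ x ] + G w  ≡⟨ homo G+ [ x ] w ⟨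
    G (x ∷ w)      ∎
    where open ≡-Reasoning

  additive-+ : ∀ {F G} → Additive F → Additive G → Additive (λ w → F w + G w)
  additive-+ {F} {G} F+ G+ = mkAdditive λ v w → trans (cong₂ _+_ (homo F+ v w) (homo G+ v w))
    (solve 4 (λ s t x y → (s :+ t) :+ (x :+ y) := (s :+ x) :+ (t :+ y)) refl (F v) (F w) (G v) (G w))

  additive-- : ∀ {F G} → Additive F → Additive G → Additive (λ w → F w - G w)
  additive-- {F} {G} F+ G+ = mkAdditive λ v w → trans (cong₂ _-_ (homo F+ v w) (homo G+ v w))
    (solve 4 (λ s t x y → (s :+ t) :- (x :+ y) := (s :- x) :+ (t :- y)) refl (F v) (F w) (G v) (G w))

  additive-* : ∀ r {F} → Additive F → Additive (λ w → r * F w)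
  additive-* r {F} F+ = mkAdditive λ v w → trans (cong (r *_) (homo F+ v w)) (*-distribˡ-+ r (F v) (F w))

  -- len# i w = |τⁱ(w)| and a# i w = |τⁱ(w)|ₐ, as rationals.
  len# a# : ℕ → List Letter → ℚ
  len# i w = ι (length (τ^ i w))
  a#   i w = ι (count a (τ^ i w))

  len#-additive : ∀ i → Additive (len# i)
  len#-additive i = mkAdditive λ v w → trans
    (cong ι (trans (cong length (τ^-++ i v w)) (length-++ (τ^ i v))))
    (ι-+ (length (τ^ i v)) (length (τ^ i w)))

  a#-additive : ∀ i → Additive (a# i)
  a#-additive i = mkAdditive λ v w → trans
    (cong ι (trans (cong (count a) (τ^-++ i v w)) (count-++ a (τ^ i v) (τ^ i w))))
    (ι-+ (count a (τ^ i v)) (count a (τ^ i w)))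

  -- The discrepancy of the letter a in τⁱ(w), for the frequency 1/q.
  D : ℚ → ℕ → List Letter → ℚ
  D q i w = len# i w - q * a# i w

  D-additive : ∀ q i → Additive (D q i)
  D-additive q i = additive-- (len#-additive i) (additive-* q (a#-additive i))

  D-antitone : ∀ {q r} i w → q ≤ r → D r i w ≤ D q i w
  D-antitone i w q≤r = +-monoʳ-≤ (len# i w)
    (neg-antimono-≤ (*-monoʳ-≤-nonNeg (a# i w) {{nonNegative (0≤ι (count a (τ^ i w)))}} q≤r))

  -- Both sides of each relation are additive, so it suffices to compare them at the letters.  The arguments
  -- lᵢ and aᵢ of the local relation are |τⁱ(x)| and |τⁱ(x)|ₐ, for x = a, b, c in turn.

  D₆-relation : ∀ q w → D q 6 w ≡
    (ι 4 - ι 2 * q) * D q 3 w - (ι 2 * γ q - 1ℚ) * D q 2 w - p q * (ι 2 * a# 2 w)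
  D₆-relation q = additive-ext (D-additive q 6)
    (additive-- (additive-- (additive-* (ι 4 - ι 2 * q) (D-additive q 3)) (additive-* (ι 2 * γ q - 1ℚ) (D-additive q 2)))
      (additive-* (p q) (additive-* (ι 2) (a#-additive 2))))
    λ { a → solve 1 (relation 44 24 7 4 4 2) refl q
      ; b → solve 1 (relation 37 20 6 3 3 2) refl q
      ; c → solve 1 (relation 24 13 4 2 2 1) refl q }
    where
    relation : (l₆ a₆ l₃ a₃ l₂ a₂ : ℕ) → Polynomial 1 → Polynomial 1 × Polynomial 1
    relation l₆ a₆ l₃ a₃ l₂ a₂ q =
      con (ι l₆) :- q :* con (ι a₆) :=
        (con (ι 4) :- con (ι 2) :* q) :* (con (ι l₃) :- q :* con (ι a₃))
        :- (con (ι 2) :* poly-γ q :- con 1ℚ) :* (con (ι l₂) :- q :* con (ι a₂))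
        :- poly-p q :* (con (ι 2) :* con (ι a₂))

  len₂-relation : ∀ q w → len# 2 w - sq q * len# 0 w ≡ D q 1 w - γ q * D q 0 w - p q * a# 0 w
  len₂-relation q = additive-ext (additive-- (len#-additive 2) (additive-* (sq q) (len#-additive 0)))
    (additive-- (additive-- (D-additive q 1) (additive-* (γ q) (D-additive q 0))) (additive-* (p q) (a#-additive 0)))
    λ { a → solve 1 (relation 4 2 1 1) refl q
      ; b → solve 1 (relation 3 2 1 0) refl q
      ; c → solve 1 (relation 2 1 1 0) refl q }
    where
    relation : (l₂ l₁ a₁ a₀ : ℕ) → Polynomial 1 → Polynomial 1 × Polynomial 1
    relation l₂ l₁ a₁ a₀ q = con (ι l₂) :- (q :* (q :* con 1ℚ)) :* con 1ℚ :=
      (con (ι l₁) :- q :* con (ι a₁)) :- poly-γ q :* (con 1ℚ :- q :* con (ι a₀)) :- poly-p q :* con (ι a₀)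

  len₃-relation : ∀ q w → len# 3 w - cube q * len# 0 w ≡
    ι 2 * D q 1 w - γ q * D q 0 w - p q * (len# 0 w + a# 0 w)
  len₃-relation q = additive-ext (additive-- (len#-additive 3) (additive-* (cube q) (len#-additive 0)))
    (additive-- (additive-- (additive-* (ι 2) (D-additive q 1)) (additive-* (γ q) (D-additive q 0)))
      (additive-* (p q) (additive-+ (len#-additive 0) (a#-additive 0))))
    λ { a → solve 1 (relation 7 2 1 1) refl q
      ; b → solve 1 (relation 6 2 1 0) refl q
      ; c → solve 1 (relation 4 1 1 0) refl q }
    where
    relation : (l₃ l₁ a₁ a₀ : ℕ) → Polynomial 1 → Polynomial 1 × Polynomial 1
    relation l₃ l₁ a₁ a₀ q = con (ι l₃) :- (q :* (q :* (q :* con 1ℚ))) :* con 1ℚ :=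
      con (ι 2) :* (con (ι l₁) :- q :* con (ι a₁)) :- poly-γ q :* (con 1ℚ :- q :* con (ι a₀))
      :- poly-p q :* (con 1ℚ :+ con (ι a₀))

  -- The index |τⁱ(T m)| + k + 1 of an occurrence with number m + 1, minus r times this number: the excess
  -- of the blocks before it and a constant.
  index-discrepancy : ∀ r i k m → ι (suc (length (τ^ i (T m)) ℕ.+ k)) - r * ι (suc m) ≡
    (ι (suc k) - r) + (len# i (T m) - r * len# 0 (T m))
  index-discrepancy r i k m = begin
    ι (suc (l ℕ.+ k)) - r * ι (suc m)
      ≡⟨ cong₂ (λ x y → x - r * y) (trans (ι-+ 1 (l ℕ.+ k)) (cong (λ x → 1ℚ + x) (ι-+ l k))) (ι-+ 1 m) ⟩
    (1ℚ + (ι l + ι k)) - r * (1ℚ + ι m)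
      ≡⟨ solve 4 (λ r x y z → (con 1ℚ :+ (x :+ y)) :- r :* (con 1ℚ :+ z) := ((con 1ℚ :+ y) :- r) :+ (x :- r :* z))
           refl r (ι l) (ι k) (ι m) ⟩
    ((1ℚ + ι k) - r) + (ι l - r * ι m)
      ≡⟨ cong₂ (λ x y → (x - r) + (ι l - r * y)) (ι-+ 1 k) (cong ι (length-T m)) ⟨
    (ι (suc k) - r) + (len# i (T m) - r * len# 0 (T m)) ∎
    where
    open ≡-Reasoning
    l = length (τ^ i (T m))

  -- Bounds for the discrepancies

  -- A rational interval around ψ = 1.83928…, and the bound for the error terms with the factor p q.
  ψ₋ ψ₊ δ : ℚ
  ψ₋ = 1839 ‰
  ψ₊ = 1840 ‰
  δ = 1 ‰

  -- Upper and lower bounds for D i on the prefixes of 𝐓, for i up to 6.  The bounds for i = 6 are chosen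
  -- so that D₆-relation reproduces them.  Every other bound is the next one plus the value of D i at a,
  -- if this value is positive (for U) or negative (for L) on the interval.
  U L : ℕ → ℚ
  U 0 = 895 ‰
  U 1 = 895 ‰
  U 2 = 734 ‰
  U 3 = 412 ‰
  U 4 = 412 ‰
  U 5 = 285 ‰
  U _ = 192 ‰
  L 0 = - (1472 ‰)
  L 1 = - (632 ‰)
  L 2 = - (632 ‰)
  L 3 = - (632 ‰)
  L _ = - (272 ‰)

  U-step : ∀ {i} → i ℕ.< 6 → U (suc i) ≤ U i × U (suc i) + D ψ₋ i [ a ] ≤ U i
  U-step = from-yes (ℕ.allUpTo? (λ i → (U (suc i) ≤? U i) ×-dec (U (suc i) + D ψ₋ i [ a ] ≤? U i)) 6)

  L-step : ∀ {i} → i ℕ.< 6 → L i ≤ L (suc i) × L i ≤ L (suc i) + D ψ₊ i [ a ]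
  L-step = from-yes (ℕ.allUpTo? (λ i → (L i ≤? L (suc i)) ×-dec (L i ≤? L (suc i) + D ψ₊ i [ a ])) 6)

  L≤0≤U : ∀ {i} → i ℕ.< 6 → L i ≤ 0ℚ × 0ℚ ≤ U i
  L≤0≤U = from-yes (ℕ.allUpTo? (λ i → (L i ≤? 0ℚ) ×-dec (0ℚ ≤? U i)) 6)

  -- The index of the occurrence with number n minus ψ n, or ψ² n, or ψ³ n, has to lie between -(k + 1) and 1,
  -- for k = 1, 2, 3.  The lower bound keeps a margin, which absorbs the ε of the order of the reals.
  Within : ℕ → ℚ → Set
  Within k x = 2 ‰ - ι (suc k) ≤ x × x ≤ 1ℚ

  within : ∀ k {x y l u} → x ≡ y → l ≤ y → y ≤ u → 2 ‰ - ι (suc k) ≤ l → u ≤ 1ℚ → Within k x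
  within k refl l≤y y≤u l-ok u-ok = ≤-trans l-ok l≤y , ≤-trans y≤u u-ok

  -- A rational q that is close enough to ψ for the prefixes of length at most N.
  module Approximant (q : ℚ) (ψ₋≤q : ψ₋ ≤ q) (q≤ψ₊ : q ≤ ψ₊)
                     (N : ℕ) (small : ∣ p q ∣ * ι (4 ℕ.* N) ≤ δ) where

    0≤q : 0ℚ ≤ q
    0≤q = ≤-trans (from-yes (0ℚ ≤? ψ₋)) ψ₋≤q

    γ-bounds : γ ψ₋ ≤ γ q × γ q ≤ γ ψ₊
    γ-bounds =
      +-monoˡ-≤ (- 1ℚ) (scale-≤ (ψ₋ - 1ℚ) (q - 1ℚ) ψ₋ q 0≤ψ₋-1 (+-monoˡ-≤ (- 1ℚ) ψ₋≤q) ψ₋≤q 0≤q) ,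
      +-monoˡ-≤ (- 1ℚ) (scale-≤ (q - 1ℚ) (ψ₊ - 1ℚ) q ψ₊
        (≤-trans 0≤ψ₋-1 (+-monoˡ-≤ (- 1ℚ) ψ₋≤q)) (+-monoˡ-≤ (- 1ℚ) q≤ψ₊) q≤ψ₊ (from-yes (0ℚ ≤? ψ₊)))
      where
      0≤ψ₋-1 : 0ℚ ≤ ψ₋ - 1ℚ
      0≤ψ₋-1 = from-yes (0ℚ ≤? ψ₋ - 1ℚ)

    0≤γ : 0ℚ ≤ γ q
    0≤γ = ≤-trans (from-yes (0ℚ ≤? γ ψ₋)) (proj₁ γ-bounds)

    error-bounds : ∀ {k} → k ℕ.≤ 4 ℕ.* N → - (p q * ι k) ≤ δ × - δ ≤ - (p q * ι k)
    error-bounds {k} k≤4N = ∣x∣≤y⇒-x≤y error≤δ , neg-antimono-≤ (∣x∣≤y⇒x≤y error≤δ)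
      where
      open ≤-Reasoning
      error≤δ : ∣ p q * ι k ∣ ≤ δ
      error≤δ = begin
        ∣ p q * ι k ∣          ≡⟨ ∣p*q∣≡∣p∣*∣q∣ (p q) (ι k) ⟩
        ∣ p q ∣ * ∣ ι k ∣      ≡⟨ cong (∣ p q ∣ *_) (0≤p⇒∣p∣≡p (0≤ι k)) ⟩
        ∣ p q ∣ * ι k          ≤⟨ *-monoˡ-≤-nonNeg ∣ p q ∣ {{∣-∣-nonNeg (p q)}} (ι-mono k≤4N) ⟩
        ∣ p q ∣ * ι (4 ℕ.* N)  ≤⟨ small ⟩
        δ                      ∎

    Balanced : List Letter → Set
    Balanced w = ∀ {i} → i ℕ.< 6 → L i ≤ D q i w × D q i w ≤ U i

    []-balanced : Balanced []
    []-balanced {i} i<6 = subst (L i ≤_) (sym D[]≡0) (proj₁ (L≤0≤U i<6)) , subst (_≤ U i) (sym D[]≡0) (proj₂ (L≤0≤U i<6))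
      where
      D[]≡0 : D q i [] ≡ 0ℚ
      D[]≡0 = homo-[] (D-additive q i)

    module _ (w : List Letter) (w≤N : length w ℕ.≤ N) (balanced : Balanced w) where

      private
        2<6 : 2 ℕ.< 6
        2<6 = from-yes (2 ℕ.<? 6)

        3<6 : 3 ℕ.< 6
        3<6 = from-yes (3 ℕ.<? 6)

        k : ℕ
        k = count a (τ^ 2 w) ℕ.+ count a (τ^ 2 w)

        k≤4N : k ℕ.≤ 4 ℕ.* N
        k≤4N = begin
          k
            ≡⟨ cong (λ n → n ℕ.+ n) (count-a-τ* (τ* w)) ⟩
          length (τ* w) ℕ.+ length (τ* w)
            ≤⟨ ℕ.+-mono-≤ (length-τ* w) (length-τ* w) ⟩
          (length w ℕ.+ length w) ℕ.+ (length w ℕ.+ length w)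
            ≤⟨ ℕ.+-mono-≤ (ℕ.+-mono-≤ w≤N w≤N) (ℕ.+-mono-≤ w≤N w≤N) ⟩
          (N ℕ.+ N) ℕ.+ (N ℕ.+ N)
            ≡⟨ ℕ.+-assoc N N (N ℕ.+ N) ⟩
          N ℕ.+ (N ℕ.+ (N ℕ.+ N))
            ≡⟨ cong (λ n → N ℕ.+ (N ℕ.+ (N ℕ.+ n))) (ℕ.+-identityʳ N) ⟨
          4 ℕ.* N ∎
          where open ℕ.≤-Reasoning

        D₆ : D q 6 w ≡ (ι 4 - ι 2 * q) * D q 3 w + (ι 2 * γ q - 1ℚ) * (- D q 2 w) + - (p q * ι k)
        D₆ = trans (D₆-relation q w) (trans
          (cong (λ x → (ι 4 - ι 2 * q) * D q 3 w - (ι 2 * γ q - 1ℚ) * D q 2 w - p q * x)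
            (trans (solve 1 (λ x → con (ι 2) :* x := x :+ x) refl (a# 2 w)) (sym (ι-+ (count a (τ^ 2 w)) (count a (τ^ 2 w))))))
          (solve 5 (λ α β x y e → α :* x :- β :* y :- e := α :* x :+ β :* (:- y) :+ (:- e)) refl
            (ι 4 - ι 2 * q) (ι 2 * γ q - 1ℚ) (D q 3 w) (D q 2 w) (p q * ι k)))

        0≤α : 0ℚ ≤ ι 4 - ι 2 * q
        0≤α = ≤-trans (from-yes (0ℚ ≤? ι 4 - ι 2 * ψ₊)) (+-monoʳ-≤ (ι 4) (neg-antimono-≤ (*-monoˡ-≤-nonNeg (ι 2) q≤ψ₊)))

        α≤ : ι 4 - ι 2 * q ≤ ι 4 - ι 2 * ψ₋
        α≤ = +-monoʳ-≤ (ι 4) (neg-antimono-≤ (*-monoˡ-≤-nonNeg (ι 2) ψ₋≤q))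

        0≤β : 0ℚ ≤ ι 2 * γ q - 1ℚ
        0≤β = ≤-trans (from-yes (0ℚ ≤? ι 2 * γ ψ₋ - 1ℚ)) (+-monoˡ-≤ (- 1ℚ) (*-monoˡ-≤-nonNeg (ι 2) (proj₁ γ-bounds)))

        β≤ : ι 2 * γ q - 1ℚ ≤ ι 2 * γ ψ₊ - 1ℚ
        β≤ = +-monoˡ-≤ (- 1ℚ) (*-monoˡ-≤-nonNeg (ι 2) (proj₂ γ-bounds))

      D₆≤U₆ : D q 6 w ≤ U 6
      D₆≤U₆ = begin
        D q 6 w
          ≡⟨ D₆ ⟩
        (ι 4 - ι 2 * q) * D q 3 w + (ι 2 * γ q - 1ℚ) * (- D q 2 w) + - (p q * ι k)
          ≤⟨ +-mono-≤ (+-mono-≤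
               (scale-≤ (ι 4 - ι 2 * q) (ι 4 - ι 2 * ψ₋) (D q 3 w) (U 3)
                 0≤α α≤ (proj₂ (balanced 3<6)) (from-yes (0ℚ ≤? U 3)))
               (scale-≤ (ι 2 * γ q - 1ℚ) (ι 2 * γ ψ₊ - 1ℚ) (- D q 2 w) (- L 2)
                 0≤β β≤ (neg-antimono-≤ (proj₁ (balanced 2<6))) (from-yes (0ℚ ≤? - L 2))))
               (proj₁ (error-bounds k≤4N)) ⟩
        (ι 4 - ι 2 * ψ₋) * U 3 + (ι 2 * γ ψ₊ - 1ℚ) * (- L 2) + δ
          ≤⟨ from-yes ((ι 4 - ι 2 * ψ₋) * U 3 + (ι 2 * γ ψ₊ - 1ℚ) * (- L 2) + δ ≤? U 6) ⟩
        U 6 ∎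
        where open ≤-Reasoning

      L₆≤D₆ : L 6 ≤ D q 6 w
      L₆≤D₆ = begin
        L 6
          ≤⟨ from-yes (L 6 ≤? (ι 4 - ι 2 * ψ₋) * L 3 + (ι 2 * γ ψ₊ - 1ℚ) * (- U 2) + - δ) ⟩
        (ι 4 - ι 2 * ψ₋) * L 3 + (ι 2 * γ ψ₊ - 1ℚ) * (- U 2) + - δ
          ≤⟨ +-mono-≤ (+-mono-≤
               (scale-≥ (ι 4 - ι 2 * q) (ι 4 - ι 2 * ψ₋) (D q 3 w) (L 3)
                 0≤α α≤ (proj₁ (balanced 3<6)) (from-yes (L 3 ≤? 0ℚ)))
               (scale-≥ (ι 2 * γ q - 1ℚ) (ι 2 * γ ψ₊ - 1ℚ) (- D q 2 w) (- U 2)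
                 0≤β β≤ (neg-antimono-≤ (proj₂ (balanced 2<6))) (from-yes (- U 2 ≤? 0ℚ))))
               (proj₂ (error-bounds k≤4N)) ⟩
        (ι 4 - ι 2 * q) * D q 3 w + (ι 2 * γ q - 1ℚ) * (- D q 2 w) + - (p q * ι k)
          ≡⟨ D₆ ⟨
        D q 6 w ∎
        where open ≤-Reasoning

      balanced≤6 : ∀ {i} → i ℕ.≤ 6 → L i ≤ D q i w × D q i w ≤ U i
      balanced≤6 {i} i≤6 =
        [ (λ i<6 → balanced {i} i<6)
        , (λ i≡6 → subst (λ i → L i ≤ D q i w × D q i w ≤ U i) (sym i≡6) (L₆≤D₆ , D₆≤U₆)) ]′
        (ℕ.m≤n⇒m<n∨m≡n i≤6)

      -- D q i (τ* w) is D q (suc i) w by definition.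
      τ*-balanced : Balanced (τ* w)
      τ*-balanced i<6 = let l , u = balanced≤6 i<6 in
        ≤-trans (proj₁ (L-step i<6)) l , ≤-trans u (proj₁ (U-step i<6))

      τ*-a-balanced : Balanced (τ* w ++ [ a ])
      τ*-a-balanced {i} i<6 = let l , u = balanced≤6 i<6 in
        subst (L i ≤_) (sym eq) (≤-trans (proj₂ (L-step i<6)) (+-mono-≤ l (D-antitone i [ a ] q≤ψ₊))) ,
        subst (_≤ U i) (sym eq) (≤-trans (+-mono-≤ u (D-antitone i [ a ] ψ₋≤q)) (proj₂ (U-step i<6)))
        where
        eq : D q i (τ* w ++ [ a ]) ≡ D q (suc i) w + D q i [ a ]
        eq = homo (D-additive q i) (τ* w) [ a ]

    parse-balanced : ∀ {n} → (∀ {m} → m ℕ.< n → m ℕ.≤ N → Balanced (T m)) → n ℕ.≤ N → Parse n → Balanced (T n)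
    parse-balanced rec n≤N (parse m d m<n eq d≡) = subst Balanced (sym eq) (by-digit d≡)
      where
      m≤N : m ℕ.≤ N
      m≤N = ℕ.≤-trans (ℕ.<⇒≤ m<n) n≤N
      ∣Tm∣≤N : length (T m) ℕ.≤ N
      ∣Tm∣≤N = subst (ℕ._≤ N) (sym (length-T m)) m≤N
      by-digit : ∀ {d} → d ≡ [] ⊎ d ≡ [ a ] → Balanced (τ* (T m) ++ d)
      by-digit (inj₁ refl) = subst Balanced (sym (++-identityʳ _)) (τ*-balanced (T m) ∣Tm∣≤N (rec m<n m≤N))
      by-digit (inj₂ refl) = τ*-a-balanced (T m) ∣Tm∣≤N (rec m<n m≤N)

    T-balanced : ∀ n → n ℕ.≤ N → Balanced (T n)
    T-balanced = <-rec (λ n → n ℕ.≤ N → Balanced (T n)) λ where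
      zero    _   _   → []-balanced
      (suc n) rec n<N → parse-balanced rec n<N (T-parse n)

    module _ {m} (m≤N : m ℕ.≤ N) where

      private
        w : List Letter
        w = T m

        D₀-bounds : L 0 ≤ D q 0 w × D q 0 w ≤ U 0
        D₀-bounds = T-balanced m m≤N {0} (from-yes (0 ℕ.<? 6))

        D₁-bounds : L 1 ≤ D q 1 w × D q 1 w ≤ U 1
        D₁-bounds = T-balanced m m≤N {1} (from-yes (1 ℕ.<? 6))

        γD₀-bounds : γ ψ₊ * (- U 0) ≤ γ q * (- D q 0 w) × γ q * (- D q 0 w) ≤ γ ψ₊ * (- L 0)
        γD₀-bounds =
          scale-≥ (γ q) (γ ψ₊) (- D q 0 w) (- U 0) 0≤γ (proj₂ γ-bounds) (neg-antimono-≤ (proj₂ D₀-bounds)) (from-yes (- U 0 ≤? 0ℚ)) ,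
          scale-≤ (γ q) (γ ψ₊) (- D q 0 w) (- L 0) 0≤γ (proj₂ γ-bounds) (neg-antimono-≤ (proj₁ D₀-bounds)) (from-yes (0ℚ ≤? - L 0))

        ≤2m⇒≤4N : ∀ {k} → k ℕ.≤ m ℕ.+ m → k ℕ.≤ 4 ℕ.* N
        ≤2m⇒≤4N k≤2m = ℕ.≤-trans k≤2m
          (ℕ.≤-trans (ℕ.+-mono-≤ m≤N m≤N) (ℕ.+-monoʳ-≤ N (ℕ.m≤m+n N (N ℕ.+ (N ℕ.+ 0)))))

        ∣w∣ₐ≤m : count a w ℕ.≤ m
        ∣w∣ₐ≤m = subst (count a w ℕ.≤_) (length-T m) (length-filter (_≟ a) w)

        error₂ : - (p q * a# 0 w) ≤ δ × - δ ≤ - (p q * a# 0 w)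
        error₂ = error-bounds (≤2m⇒≤4N (ℕ.≤-trans ∣w∣ₐ≤m (ℕ.m≤m+n m m)))

        error₃ : - (p q * ι (length w ℕ.+ count a w)) ≤ δ × - δ ≤ - (p q * ι (length w ℕ.+ count a w))
        error₃ = error-bounds (≤2m⇒≤4N (ℕ.+-mono-≤ (ℕ.≤-reflexive (length-T m)) ∣w∣ₐ≤m))

      A-within : Within 1 (ι (A (suc m)) - q * ι (suc m))
      A-within = within 1
        (trans (cong (λ n → ι n - q * ι (suc m)) (A-suc m)) (trans (index-discrepancy q 1 0 m)
          (cong (λ n → (1ℚ - q) + (len# 1 w - q * ι n)) (sym (count-a-τ* w)))))
        (+-mono-≤ (+-monoʳ-≤ 1ℚ (neg-antimono-≤ q≤ψ₊)) (proj₁ D₁-bounds))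
        (+-mono-≤ (+-monoʳ-≤ 1ℚ (neg-antimono-≤ ψ₋≤q)) (proj₂ D₁-bounds))
        (from-yes (2 ‰ - ι 2 ≤? (1ℚ - ψ₊) + L 1))
        (from-yes ((1ℚ - ψ₋) + U 1 ≤? 1ℚ))

      B-within : Within 2 (ι (B (suc m)) - sq q * ι (suc m))
      B-within = within 2
        (trans (cong (λ n → ι n - sq q * ι (suc m)) (B-suc m)) (trans (index-discrepancy (sq q) 2 1 m)
          (cong (λ x → (ι 2 - sq q) + x) (trans (len₂-relation q w)
            (solve 4 (λ x y z e → x :- y :* z :- e := (x :+ y :* (:- z)) :+ (:- e)) refl
              (D q 1 w) (γ q) (D q 0 w) (p q * a# 0 w))))))
        (+-mono-≤ (+-monoʳ-≤ (ι 2) (neg-antimono-≤ (sq-mono 0≤q q≤ψ₊)))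
          (+-mono-≤ (+-mono-≤ (proj₁ D₁-bounds) (proj₁ γD₀-bounds)) (proj₂ error₂)))
        (+-mono-≤ (+-monoʳ-≤ (ι 2) (neg-antimono-≤ (sq-mono (from-yes (0ℚ ≤? ψ₋)) ψ₋≤q)))
          (+-mono-≤ (+-mono-≤ (proj₂ D₁-bounds) (proj₂ γD₀-bounds)) (proj₁ error₂)))
        (from-yes (2 ‰ - ι 3 ≤? (ι 2 - sq ψ₊) + ((L 1 + γ ψ₊ * (- U 0)) + - δ)))
        (from-yes ((ι 2 - sq ψ₋) + ((U 1 + γ ψ₊ * (- L 0)) + δ) ≤? 1ℚ))

      C-within : Within 3 (ι (C (suc m)) - cube q * ι (suc m))
      C-within = within 3
        (trans (cong (λ n → ι n - cube q * ι (suc m)) (C-suc m)) (trans (index-discrepancy (cube q) 3 3 m)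
          (cong (λ x → (ι 4 - cube q) + x) (trans (len₃-relation q w) (trans
            (cong (λ x → ι 2 * D q 1 w - γ q * D q 0 w - p q * x) (sym (ι-+ (length w) (count a w))))
            (solve 4 (λ x y z e → x :- y :* z :- e := (x :+ y :* (:- z)) :+ (:- e)) refl
              (ι 2 * D q 1 w) (γ q) (D q 0 w) (p q * ι (length w ℕ.+ count a w))))))))
        (+-mono-≤ (+-monoʳ-≤ (ι 4) (neg-antimono-≤ (cube-mono 0≤q q≤ψ₊)))
          (+-mono-≤ (+-mono-≤ (*-monoˡ-≤-nonNeg (ι 2) (proj₁ D₁-bounds)) (proj₁ γD₀-bounds)) (proj₂ error₃)))
        (+-mono-≤ (+-monoʳ-≤ (ι 4) (neg-antimono-≤ (cube-mono (from-yes (0ℚ ≤? ψ₋)) ψ₋≤q)))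
          (+-mono-≤ (+-mono-≤ (*-monoˡ-≤-nonNeg (ι 2) (proj₂ D₁-bounds)) (proj₂ γD₀-bounds)) (proj₁ error₃)))
        (from-yes (2 ‰ - ι 4 ≤? (ι 4 - cube ψ₊) + ((ι 2 * L 1 + γ ψ₊ * (- U 0)) + - δ)))
        (from-yes ((ι 4 - cube ψ₋) + ((ι 2 * U 1 + γ ψ₊ * (- L 0)) + δ) ≤? 1ℚ))

  -- Localisation of the root

  -- The quotient (p x - p r) / (x - r) = x² + (r - 1) x + r² - r - 1, with the square completed;
  -- what remains is the constant rest r.
  rest : ℚ → ℚ
  rest r = γ r - ½ * (r - 1ℚ) * (½ * (r - 1ℚ))

  slope : ℚ → ℚ → ℚ
  slope r x = (x + ½ * (r - 1ℚ)) * (x + ½ * (r - 1ℚ)) + rest r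

  p-slope : ∀ r x → p x ≡ p r + (x - r) * slope r x
  p-slope = solve 2 (λ r x → poly-p x := poly-p r :+ (x :- r) :*
    ((x :+ con ½ :* (r :- con 1ℚ)) :* (x :+ con ½ :* (r :- con 1ℚ))
      :+ (poly-γ r :- con ½ :* (r :- con 1ℚ) :* (con ½ :* (r :- con 1ℚ))))) refl

  module _ (r : ℚ) (0≤rest : 0ℚ ≤ rest r) where

    private
      p-slope-0 : ∀ x → p r + 0ℚ * slope r x ≡ p r
      p-slope-0 x = trans (cong (λ y → p r + y) (*-zeroˡ (slope r x))) (+-identityʳ (p r))

      0≤slope : ∀ x → 0ℚ ≤ slope r x
      0≤slope x = +-mono-≤ (0≤x*x (x + ½ * (r - 1ℚ))) 0≤rest

    p-below : ∀ {x} → x ≤ r → p x ≤ p r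
    p-below {x} x≤r = subst₂ _≤_ (sym (p-slope r x)) (p-slope-0 x)
      (+-monoʳ-≤ (p r) (*-monoʳ-≤-nonNeg (slope r x) {{nonNegative (0≤slope x)}}
        (subst (x - r ≤_) (+-inverseʳ r) (+-monoˡ-≤ (- r) x≤r))))

    p-above : ∀ {x} → r ≤ x → p r ≤ p x
    p-above {x} r≤x = subst₂ _≤_ (p-slope-0 x) (sym (p-slope r x))
      (+-monoʳ-≤ (p r) (*-monoʳ-≤-nonNeg (slope r x) {{nonNegative (0≤slope x)}}
        (subst (_≤ x - r) (+-inverseʳ r) (+-monoˡ-≤ (- r) r≤x))))

  near-root : ∀ q → ∣ p q ∣ ≤ δ → ψ₋ ≤ q × q ≤ ψ₊
  near-root q ∣pq∣≤δ =
    ≮⇒≥ (λ q<ψ₋ → <-irrefl refl (<-≤-trans (from-yes (p ψ₋ <? - δ))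
      (≤-trans (∣x∣≤y⇒-y≤x ∣pq∣≤δ) (p-below ψ₋ (from-yes (0ℚ ≤? rest ψ₋)) (<⇒≤ q<ψ₋))))) ,
    ≮⇒≥ (λ ψ₊<q → <-irrefl refl (<-≤-trans (from-yes (δ <? p ψ₊))
      (≤-trans (p-above ψ₊ (from-yes (0ℚ ≤? rest ψ₊)) (<⇒≤ ψ₊<q)) (∣x∣≤y⇒x≤y ∣pq∣≤δ))))

  -- The witness is δ / (N + 1).
  tolerance : ∀ N → ∃ λ ε → 0ℚ < ε × ε ≤ δ × ε * ι N ≤ δ
  tolerance N = ε , positive⁻¹ ε ,
      subst (_≤ δ) (*-identityʳ ε) (≤-trans (*-monoˡ-≤-nonNeg ε (ι-mono {1} {suc N} (s≤s z≤n))) (≤-reflexive εM≡δ)) ,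
      ≤-trans (*-monoˡ-≤-nonNeg ε (ι-mono (ℕ.n≤1+n N))) (≤-reflexive εM≡δ)
    where
    M = ι (suc N)
    instance
      M>0 : Positive M
      M>0 = normalize-pos (suc N) 1
      M≢0 : NonZero M
      M≢0 = pos⇒nonZero M
      1/M>0 : Positive (1/ M)
      1/M>0 = 1/pos⇒pos M
    ε = δ * 1/ M
    instance
      ε>0 : Positive ε
      ε>0 = pos*pos⇒pos δ (1/ M)
      ε≥0 : NonNegative ε
      ε≥0 = pos⇒nonNeg ε
    εM≡δ : ε * M ≡ δ
    εM≡δ = trans (*-assoc δ (1/ M) M) (trans (cong (δ *_) (*-inverseˡ M)) (*-identityʳ δ))

  -- From rational approximants to the floor

  within-0 : ∀ k r → Within k (ι 0 - r * ι 0)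
  within-0 k r = subst (Within k) (solve 1 (λ r → con 0ℚ := con 0ℚ :- r :* con 0ℚ) refl r)
    ( ≤-trans (+-monoʳ-≤ (2 ‰) (neg-antimono-≤ (ι-mono {1} {suc k} (s≤s z≤n)))) (from-yes (2 ‰ - ι 1 ≤? 0ℚ))
    , from-yes (0ℚ ≤? 1ℚ))

  indices-within : ∀ q n → ∣ p q ∣ ≤ δ → ∣ p q ∣ * ι (4 ℕ.* n) ≤ δ →
    Within 1 (ι (A n) - q * ι n) × Within 2 (ι (B n) - sq q * ι n) × Within 3 (ι (C n) - cube q * ι n)
  indices-within q zero    _      _     = within-0 1 q , within-0 2 (sq q) , within-0 3 (cube q)
  indices-within q (suc m) ∣pq∣≤δ small = A-within m≤1+m , B-within m≤1+m , C-within m≤1+m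
    where
    open Approximant q (proj₁ (near-root q ∣pq∣≤δ)) (proj₂ (near-root q ∣pq∣≤δ)) (suc m) small
    m≤1+m = ℕ.n≤1+n m

  -- The integer z is compared with the floor f of x at one late index j of the sequence x.
  floor-bounds : ∀ x z k f → (∃ λ M → ∀ j → M ℕ.≤ j → Within k (ι z - seq x j)) → ⌊ x ⌋≡ f →
    f ℤ.- + k ℤ.≤ + z × + z ℤ.≤ f ℤ.+ + 1
  floor-bounds x z k f (M , near) (f≤x , ε , 0<ε , N₂ , x<f+1) = lower , upper
    where
    N₁ = proj₁ (f≤x δ (from-yes (0ℚ <? δ)))
    j = M ℕ.⊔ (N₁ ℕ.⊔ N₂)
    nearⱼ = near j (ℕ.m≤m⊔n M _)
    f≤xⱼ+δ : fromInt f ≤ seq x j + δ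
    f≤xⱼ+δ = proj₂ (f≤x δ (from-yes (0ℚ <? δ))) j (ℕ.≤-trans (ℕ.m≤m⊔n N₁ N₂) (ℕ.m≤n⊔m M _))
    xⱼ+ε≤f+1 : seq x j + ε ≤ fromInt (f ℤ.+ + 1)
    xⱼ+ε≤f+1 = x<f+1 j (ℕ.≤-trans (ℕ.m≤n⊔m N₁ N₂) (ℕ.m≤n⊔m M _))

    f<z+1+k : f ℤ.< + z ℤ.+ + suc k
    f<z+1+k = fromInt-cancel-< (begin-strict
      fromInt f
        ≤⟨ f≤xⱼ+δ ⟩
      seq x j + δ
        ≡⟨ solve 4 (λ x d z l → x :+ d := ((x :+ d) :- z :+ l) :+ (z :- l)) refl (seq x j) δ (ι z) l ⟩
      (seq x j + δ - ι z + l) + (ι z - l)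
        ≤⟨ +-monoˡ-≤ (ι z - l) (+-monoʳ-≤ (seq x j + δ - ι z) (proj₁ nearⱼ)) ⟩
      (seq x j + δ - ι z + (ι z - seq x j)) + (ι z - l)
        ≡⟨ solve 5 (λ x d z t s → (x :+ d :- z :+ (z :- x)) :+ (z :- (t :- s)) := (z :+ s) :+ (d :- t))
             refl (seq x j) δ (ι z) (2 ‰) (ι (suc k)) ⟩
      (ι z + ι (suc k)) + (δ - 2 ‰)
        <⟨ +-monoʳ-< (ι z + ι (suc k)) (from-yes (δ - 2 ‰ <? 0ℚ)) ⟩
      (ι z + ι (suc k)) + 0ℚ
        ≡⟨ +-identityʳ _ ⟩
      ι z + ι (suc k)
        ≡⟨ fromInt-+ (+ z) (+ suc k) ⟨
      fromInt (+ z ℤ.+ + suc k) ∎)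
      where
      open ≤-Reasoning
      l = 2 ‰ - ι (suc k)

    z<f+1+1 : + z ℤ.< (f ℤ.+ + 1) ℤ.+ + 1
    z<f+1+1 = fromInt-cancel-< (begin-strict
      ι z                            ≡⟨ solve 2 (λ z x → z := x :+ (z :- x)) refl (ι z) (seq x j) ⟩
      seq x j + (ι z - seq x j)      ≤⟨ +-monoʳ-≤ (seq x j) (proj₂ nearⱼ) ⟩
      seq x j + 1ℚ                   ≡⟨ cong (_+ 1ℚ) (+-identityʳ (seq x j)) ⟨
      seq x j + 0ℚ + 1ℚ              <⟨ +-monoˡ-< 1ℚ (+-monoʳ-< (seq x j) 0<ε) ⟩
      seq x j + ε + 1ℚ               ≤⟨ +-monoˡ-≤ 1ℚ xⱼ+ε≤f+1 ⟩
      fromInt (f ℤ.+ + 1) + 1ℚ       ≡⟨ fromInt-+ (f ℤ.+ + 1) (+ 1) ⟨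
      fromInt ((f ℤ.+ + 1) ℤ.+ + 1)  ∎)
      where open ≤-Reasoning

    upper : + z ℤ.≤ f ℤ.+ + 1
    upper = subst (+ z ℤ.≤_) (trans (cong ℤ.pred (ℤ.+-comm (f ℤ.+ + 1) (+ 1))) (ℤ.pred-suc (f ℤ.+ + 1)))
      (ℤ.i<j⇒i≤pred[j] z<f+1+1)

    f≤z+k : f ℤ.≤ + z ℤ.+ + k
    f≤z+k = ℤ.i<j⇒i≤pred[j] (subst (λ m → f ℤ.< + m) (ℕ.+-suc z k) f<z+1+k)

    lower : f ℤ.- + k ℤ.≤ + z
    lower = subst (f ℤ.- + k ℤ.≤_)
      (trans (ℤ.+-assoc (+ z) (+ k) (ℤ.- + k)) (trans (cong (λ i → + z ℤ.+ i) (ℤ.+-inverseʳ (+ k))) (ℤ.+-identityʳ (+ z))))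
      (ℤ.+-monoˡ-≤ (ℤ.- + k) f≤z+k)

  -- At late indices j, p (seq ψ j) is small enough for the number n, and the three differences are
  -- the entries at j of the sequences that represent A n - ψ n, B n - ψ² n and C n - ψ³ n.
  eventually-within : ∀ ψ → IsTribonacciConstant ψ → ∀ n → ∃ λ M → ∀ j → M ℕ.≤ j →
    Within 1 (ι (A n) - seq ψ j * ι n) × Within 2 (ι (B n) - sq (seq ψ j) * ι n) ×
    Within 3 (ι (C n) - cube (seq ψ j) * ι n)
  eventually-within ψ root n =
    let ε , 0<ε , ε≤δ , ε·4n≤δ = tolerance (4 ℕ.* n)
        M , p→0 = root ε 0<ε
    in M , λ j M≤j →
      let ∣p∣≤ε = <⇒≤ (p→0 j M≤j) in
      indices-within (seq ψ j) n (≤-trans ∣p∣≤ε ε≤δ)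
        (≤-trans (*-monoʳ-≤-nonNeg (ι (4 ℕ.* n)) {{nonNegative (0≤ι (4 ℕ.* n))}} ∣p∣≤ε) ε·4n≤δ)

open import Data.Integer.Base using (_-_; _+_; _≤_)
open import Defs using (_*_; _^_)
open Estimates using (floor-bounds; eventually-within)

theorem16 : (ψ : ℝ) → IsTribonacciConstant ψ → (n : ℕ) →
    ((f : ℤ) → ⌊ ψ * fromℤ (+ n) ⌋≡ f → f - + 1 ≤ + A n × + A n ≤ f + + 1) ×
    ((f : ℤ) → ⌊ ψ ^ 2 * fromℤ (+ n) ⌋≡ f → f - + 2 ≤ + B n × + B n ≤ f + + 1) ×
    ((f : ℤ) → ⌊ ψ ^ 3 * fromℤ (+ n) ⌋≡ f → f - + 3 ≤ + C n × + C n ≤ f + + 1)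
theorem16 ψ root n =
  let M , near = eventually-within ψ root n in
    (λ f → floor-bounds (ψ * fromℤ (+ n)) (A n) 1 f (M , λ j M≤j → proj₁ (near j M≤j)))
  , (λ f → floor-bounds (ψ ^ 2 * fromℤ (+ n)) (B n) 2 f (M , λ j M≤j → proj₁ (proj₂ (near j M≤j))))
  , (λ f → floor-bounds (ψ ^ 3 * fromℤ (+ n)) (C n) 3 f (M , λ j M≤j → proj₂ (proj₂ (near j M≤j))))
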